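{- Let $G=(V,E)$ be a finite simple undirected graph with $n=|V|$ even which has a pfaffian orientation, and let $w:E\to[0,\infty)$ be a weight function on the edges. Then $$\operatorname{perfmat} G_w\le \prod_{v\in V}\bigl(d_{w,2}(v)\bigr)^{1/4},\qquad d_{w,2}(v):=\sum_{u:\,(u,v)\in E} w(u,v)^2 .$$ In particular, the number $\operatorname{perfmat} G$ of perfect matchings of $G$ satisfies $$\operatorname{perfmat} G\le\prod_{v\in V} d(v)^{1/4},$$ where $d(v)$ is the degree of $v$ in $G$.
   Context: $\operatorname{perfmat} G$ is the number of perfect matchings of $G$. For a weight function $w:E\to[0,\infty)$, $\operatorname{perfmat} G_w:=\sum_{M}\prod_{e\in M}w(e)$, the sum being over all perfect matchings $M$ of $G$. For an orientation of the edges of $G$, the skew symmetric adjacency matrix is $S(G)=[s_{uv}]_{u,v\in V}$ with $s_{uv}=1$ if the edge $(u,v)\in E$ is oriented from $u$ to $v$, $s_{uv}=-1$ if it is oriented from $v$ to $u$, and $s_{uv}=0$ if $(u,v)\notin E$. An orientation is pfaffian if $\det S(G)=(\operatorname{perfmat} G)^2$. -}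

module Defs where

open import Level using (0ℓ)
open import Data.Nat.Base as ℕ using (ℕ; zero; suc)
import Data.Nat.Properties as ℕ
open import Data.Integer.Base as ℤ using (ℤ; +_; -[1+_]; 0ℤ; 1ℤ; -1ℤ)
import Data.Integer.Properties as ℤ
open import Data.Rational.Base as ℚ
  using (ℚ; 0ℚ; 1ℚ; ½; ∣_∣; ↥_; ↧_; toℚᵘ; mkℚ)
import Data.Rational.Properties as ℚ
open import Data.Rational.Unnormalised.Base as ℚᵘ using (ℚᵘ; mkℚᵘ)
import Data.Rational.Unnormalised.Properties as ℚᵘ
open import Data.Rational.Solver using (module +-*-Solver)
open import Data.Fin.Base as Fin using (Fin; punchIn; toℕ)
import Data.Fin.Properties as Fin
open import Data.List.Base
  using (List; []; _∷_; _++_; map; foldr; filter; length; allFin; cartesianProduct)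
open import Data.Product.Base using (_×_; _,_; ∃-syntax; uncurry)
open import Data.Sum.Base using (_⊎_; inj₁; inj₂)
open import Relation.Binary.Core using (Rel)
open import Relation.Binary.Definitions using (Decidable; Symmetric; Asymmetric)
open import Relation.Binary.PropositionalEquality
  using (_≡_; refl; sym; trans; cong; cong₂; subst)
open import Relation.Nullary.Decidable using (Dec; does; yes; no; _×-dec_; _⊎-dec_)
open import Relation.Nullary.Negation using (¬_; contradiction)
open import Data.Bool.Base using (if_then_else_)

module _ where
  open import Data.Rational.Base hiding (nonNeg)
  open ℚ.≤-Reasoning
  open +-*-Solver

  +-half : ∀ ε → ε * ½ + ε * ½ ≡ ε
  +-half ε = trans (sym (ℚ.*-distribˡ-+ ε ½ ½)) (ℚ.*-identityʳ ε)

  pos*pos : ∀ {p q} → 0ℚ < p → 0ℚ < q → 0ℚ < p * q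
  pos*pos {p} {q} 0<p 0<q =
    ℚ.positive⁻¹ (p * q)
      {{ℚ.pos*pos⇒pos p {{positive 0<p}} q {{positive 0<q}}}}

  nonNeg*nonNeg : ∀ {p q} → 0ℚ ≤ p → 0ℚ ≤ q → 0ℚ ≤ p * q
  nonNeg*nonNeg {p} {q} 0≤p 0≤q =
    ℚ.nonNegative⁻¹ (p * q)
      {{ℚ.nonNeg*nonNeg⇒nonNeg p {{nonNegative 0≤p}} q {{nonNegative 0≤q}}}}

  nonNeg+nonNeg : ∀ {p q} → 0ℚ ≤ p → 0ℚ ≤ q → 0ℚ ≤ p + q
  nonNeg+nonNeg = ℚ.+-mono-≤

  half-pos : ∀ {ε} → 0ℚ < ε → 0ℚ < ε * ½
  half-pos 0<ε = pos*pos 0<ε (ℚ.positive⁻¹ ½)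

  ∣p-q∣≡∣q-p∣ : ∀ p q → ∣ p - q ∣ ≡ ∣ q - p ∣
  ∣p-q∣≡∣q-p∣ p q = trans (cong ∣_∣ (lem p q)) (ℚ.∣-p∣≡∣p∣ (q - p))
    where
    lem : ∀ p q → p - q ≡ - (q - p)
    lem = solve 2 (λ p q → p :- q := :- (q :- p)) refl

  p≤∣p∣ : ∀ p → p ≤ ∣ p ∣
  p≤∣p∣ p with ℚ.≤-total 0ℚ p
  ... | inj₁ 0≤p = ℚ.≤-reflexive (sym (ℚ.0≤p⇒∣p∣≡p 0≤p))
  ... | inj₂ p≤0 = ℚ.≤-trans p≤0 (ℚ.0≤∣p∣ p)

  abs<⇒<+ : ∀ {p q ε} → ∣ p - q ∣ < ε → p < q + ε
  abs<⇒<+ {p} {q} {ε} h = begin-strict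
    p            ≡⟨ lem p q ⟩
    q + (p - q)  <⟨ ℚ.+-monoʳ-< q (ℚ.≤-<-trans (p≤∣p∣ (p - q)) h) ⟩
    q + ε        ∎
    where
    lem : ∀ p q → p ≡ q + (p - q)
    lem = solve 2 (λ p q → p := q :+ (p :- q)) refl

  <+⇒abs< : ∀ {p q ε} → p < q + ε → q < p + ε → ∣ p - q ∣ < ε
  <+⇒abs< {p} {q} {ε} h₁ h₂ with ℚ.∣p∣≡p∨∣p∣≡-p (p - q)
  ... | inj₁ e = begin-strict
    ∣ p - q ∣  ≡⟨ e ⟩
    p - q      <⟨ ℚ.+-monoˡ-< (- q) h₁ ⟩
    q + ε - q  ≡⟨ solve 2 (λ q ε → q :+ ε :- q := ε) refl q ε ⟩
    ε          ∎
  ... | inj₂ e = begin-strict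
    ∣ p - q ∣  ≡⟨ e ⟩
    - (p - q)  ≡⟨ solve 2 (λ p q → :- (p :- q) := q :- p) refl p q ⟩
    q - p      <⟨ ℚ.+-monoˡ-< (- p) h₂ ⟩
    p + ε - p  ≡⟨ solve 2 (λ p ε → p :+ ε :- p := ε) refl p ε ⟩
    ε          ∎

  +-close : ∀ {a b c d ε} → ∣ a - c ∣ < ε * ½ → ∣ b - d ∣ < ε * ½ →
            ∣ (a + b) - (c + d) ∣ < ε
  +-close {a} {b} {c} {d} {ε} h₁ h₂ = begin-strict
    ∣ (a + b) - (c + d) ∣    ≡⟨ cong ∣_∣ (lem a b c d) ⟩
    ∣ (a - c) + (b - d) ∣    ≤⟨ ℚ.∣p+q∣≤∣p∣+∣q∣ (a - c) (b - d) ⟩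
    ∣ a - c ∣ + ∣ b - d ∣    <⟨ ℚ.+-mono-< h₁ h₂ ⟩
    ε * ½ + ε * ½            ≡⟨ +-half ε ⟩
    ε                        ∎
    where
    lem : ∀ a b c d → (a + b) - (c + d) ≡ (a - c) + (b - d)
    lem = solve 4 (λ a b c d → (a :+ b) :- (c :+ d) := (a :- c) :+ (b :- d)) refl

  *-close : ∀ {a b c d δ B} → 0ℚ < B → ∣ a ∣ < B → ∣ d ∣ < B →
            ∣ a - c ∣ < δ → ∣ b - d ∣ < δ →
            ∣ a * b - c * d ∣ < B * δ + B * δ
  *-close {a} {b} {c} {d} {δ} {B} 0<B ha hd h₁ h₂ = begin-strict
    ∣ a * b - c * d ∣                    ≡⟨ cong ∣_∣ (lem a b c d) ⟩
    ∣ a * (b - d) + d * (a - c) ∣        ≤⟨ ℚ.∣p+q∣≤∣p∣+∣q∣ (a * (b - d)) (d * (a - c)) ⟩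
    ∣ a * (b - d) ∣ + ∣ d * (a - c) ∣    ≡⟨ cong₂ _+_ (ℚ.∣p*q∣≡∣p∣*∣q∣ a (b - d))
                                                       (ℚ.∣p*q∣≡∣p∣*∣q∣ d (a - c)) ⟩
    ∣ a ∣ * ∣ b - d ∣ + ∣ d ∣ * ∣ a - c ∣  <⟨ ℚ.+-mono-< (bound ha h₂) (bound hd h₁) ⟩
    B * δ + B * δ                        ∎
    where
    lem : ∀ a b c d → a * b - c * d ≡ a * (b - d) + d * (a - c)
    lem = solve 4 (λ a b c d →
      a :* b :- c :* d := a :* (b :- d) :+ d :* (a :- c)) refl
    bound : ∀ {x y} → ∣ x ∣ < B → ∣ y ∣ < δ → ∣ x ∣ * ∣ y ∣ < B * δ
    bound {x} {y} hx hy = begin-strict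
      ∣ x ∣ * ∣ y ∣  ≤⟨ ℚ.*-monoʳ-≤-nonNeg ∣ y ∣ {{ℚ.∣-∣-nonNeg y}} (ℚ.<⇒≤ hx) ⟩
      B * ∣ y ∣      <⟨ ℚ.*-monoʳ-<-pos B {{positive 0<B}} hy ⟩
      B * δ          ∎

  modulus : ∀ {B ε} → 0ℚ < B → 0ℚ < ε → ∃[ δ ] (0ℚ < δ × B * δ + B * δ ≡ ε)
  modulus {B} {ε} 0<B 0<ε = δ , 0<δ , eq
    where
    instance
      B-pos : Positive B
      B-pos = positive 0<B
      B-nz : NonZero B
      B-nz = ℚ.pos⇒nonZero B
    δ = 1/ B * (ε * ½)
    0<δ : 0ℚ < δ
    0<δ = pos*pos (ℚ.positive⁻¹ (1/ B) {{ℚ.1/pos⇒pos B}}) (half-pos 0<ε)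
    Bδ : B * δ ≡ ε * ½
    Bδ = trans (sym (ℚ.*-assoc B (1/ B) (ε * ½)))
        (trans (cong (_* (ε * ½)) (ℚ.*-inverseʳ B)) (ℚ.*-identityˡ (ε * ½)))
    eq : B * δ + B * δ ≡ ε
    eq = trans (cong₂ _+_ Bδ Bδ) (+-half ε)

  infix 9 _⁴
  _⁴ : ℚ → ℚ
  q ⁴ = (q * q) * (q * q)

  sq-mono : ∀ {p q} → 0ℚ ≤ p → p ≤ q → p * p ≤ q * q
  sq-mono {p} {q} 0≤p p≤q = begin
    p * p  ≤⟨ ℚ.*-monoˡ-≤-nonNeg p {{nonNegative 0≤p}} p≤q ⟩
    p * q  ≤⟨ ℚ.*-monoʳ-≤-nonNeg q {{nonNegative (ℚ.≤-trans 0≤p p≤q)}} p≤q ⟩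
    q * q  ∎

  sq-superadd : ∀ {p q} → 0ℚ ≤ p → 0ℚ ≤ q → p * p + q * q ≤ (p + q) * (p + q)
  sq-superadd {p} {q} 0≤p 0≤q = begin
    p * p + q * q                    ≡⟨ sym (ℚ.+-identityʳ _) ⟩
    p * p + q * q + 0ℚ               ≤⟨ ℚ.+-monoʳ-≤ (p * p + q * q) (nonNeg+nonNeg 0≤pq 0≤pq) ⟩
    p * p + q * q + (p * q + p * q)  ≡⟨ lem p q ⟩
    (p + q) * (p + q)                ∎
    where
    0≤pq = nonNeg*nonNeg 0≤p 0≤q
    lem : ∀ p q → p * p + q * q + (p * q + p * q) ≡ (p + q) * (p + q)
    lem = solve 2 (λ p q →
      p :* p :+ q :* q :+ (p :* q :+ p :* q) := (p :+ q) :* (p :+ q)) refl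

  sq-nonNeg : ∀ {p} → 0ℚ ≤ p → 0ℚ ≤ p * p
  sq-nonNeg 0≤p = nonNeg*nonNeg 0≤p 0≤p

  ⁴-mono : ∀ {p q} → 0ℚ ≤ p → p ≤ q → p ⁴ ≤ q ⁴
  ⁴-mono 0≤p p≤q = sq-mono (sq-nonNeg 0≤p) (sq-mono 0≤p p≤q)

  ⁴-superadd : ∀ {p q} → 0ℚ ≤ p → 0ℚ ≤ q → p ⁴ + q ⁴ ≤ (p + q) ⁴
  ⁴-superadd 0≤p 0≤q = ℚ.≤-trans
    (sq-superadd (sq-nonNeg 0≤p) (sq-nonNeg 0≤q))
    (sq-mono (nonNeg+nonNeg (sq-nonNeg 0≤p) (sq-nonNeg 0≤q)) (sq-superadd 0≤p 0≤q))

  ⁴-pos : ∀ {p} → 0ℚ < p → 0ℚ < p ⁴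
  ⁴-pos 0<p = pos*pos (pos*pos 0<p 0<p) (pos*pos 0<p 0<p)

  1≤⇒≤⁴ : ∀ {p} → 1ℚ ≤ p → p ≤ p ⁴
  1≤⇒≤⁴ {p} 1≤p = ℚ.≤-trans p≤p² (sq-mono 0≤p p≤p²)
    where
    0≤p = ℚ.≤-trans (ℚ.nonNegative⁻¹ 1ℚ) 1≤p
    p≤p² : p ≤ p * p
    p≤p² = begin
      p       ≡⟨ sym (ℚ.*-identityʳ p) ⟩
      p * 1ℚ  ≤⟨ ℚ.*-monoˡ-≤-nonNeg p {{nonNegative 0≤p}} 1≤p ⟩
      p * p   ∎

  toℚᵘ-/ : ∀ i n → toℚᵘ (i / suc n) ℚᵘ.≃ mkℚᵘ i n
  toℚᵘ-/ i n = ℚ.toℚᵘ-fromℚᵘ (mkℚᵘ i n)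

  suc/ : ∀ k n → + suc k / suc n ≡ + k / suc n + + 1 / suc n
  suc/ k n = ℚ.toℚᵘ-injective (ℚᵘ.≃-trans (toℚᵘ-/ (+ suc k) n) (ℚᵘ.≃-sym
    (ℚᵘ.≃-trans (ℚ.toℚᵘ-homo-+ (+ k / suc n) (+ 1 / suc n))
    (ℚᵘ.≃-trans (ℚᵘ.+-cong (toℚᵘ-/ (+ k) n) (toℚᵘ-/ (+ 1) n)) eq))))
    where
    eq : mkℚᵘ (+ k) n ℚᵘ.+ mkℚᵘ (+ 1) n ℚᵘ.≃ mkℚᵘ (+ suc k) n
    eq = ℚᵘ.*≡* (trans
      (cong (ℤ._* + suc n) (trans (sym (ℤ.*-distribʳ-+ (+ suc n) (+ k) (+ 1)))
                                  (cong (λ i → + i ℤ.* + suc n) (ℕ.+-comm k 1))))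
      (ℤ.*-assoc (+ suc k) (+ suc n) (+ suc n)))

  /-nonNeg : ∀ k n → 0ℚ ≤ + k / suc n
  /-nonNeg k n = ℚ.nonNegative⁻¹ _ {{ℚ.normalize-nonNeg k (suc n)}}

  /-small : ∀ {δ} → 0ℚ < δ → ∃[ N ] (∀ n → N ℕ.≤ n → + 1 / suc n < δ)
  /-small {mkℚ (+ suc a) d c} _ = suc d , λ n d<n →
    ℚ.toℚᵘ-cancel-< (ℚᵘ.<-respˡ-≃ (ℚᵘ.≃-sym (toℚᵘ-/ (+ 1) n))
      (ℚᵘ.*<* (ℤ.+<+ (ℕ.≤-trans (ℕ.s≤s (subst (ℕ._≤ n) (sym (ℕ.+-identityʳ (suc d))) d<n))
                                 (ℕ.m≤m+n (suc n) (a ℕ.* suc n))))))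
  /-small {mkℚ (+ zero) d c}    (*<* (ℤ.+<+ ()))
  /-small {mkℚ (-[1+ a ]) d c} (*<* ())

  -- the largest j / (n + 1) with j ≤ k and (j / (n + 1))⁴ ≤ q, or 0 if
  -- there is none
  gridRoot : ℕ → ℚ → ℕ → ℚ
  gridRoot n q zero    = 0ℚ
  gridRoot n q (suc k) =
    if does ((+ suc k / suc n) ⁴ ℚ.≤? q) then + suc k / suc n else gridRoot n q k

  -- the cut-off k is so large that ((k + 1) / (n + 1))⁴ > q
  approxRoot : ℕ → ℚ → ℚ
  approxRoot n q = gridRoot n q (suc ℤ.∣ ↥ q ∣ ℕ.* suc n)

  record ApproxRoot (n : ℕ) (q r : ℚ) : Set where
    field
      nonNeg : 0ℚ ≤ r
      lower  : 0ℚ < r → r ⁴ ≤ q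
      upper  : q < (r + + 1 / suc n) ⁴

  gridRoot-correct : ∀ n q k → q < (+ suc k / suc n) ⁴ →
                     ApproxRoot n q (gridRoot n q k)
  gridRoot-correct n q zero h = record
    { nonNeg = ℚ.≤-refl
    ; lower  = λ 0<0 → contradiction 0<0 (ℚ.<-irrefl refl)
    ; upper  = subst (λ t → q < t ⁴) (sym (ℚ.+-identityˡ (+ 1 / suc n))) h
    }
  gridRoot-correct n q (suc k) h = select ((+ suc k / suc n) ⁴ ℚ.≤? q)
    where
    select : (d : Dec ((+ suc k / suc n) ⁴ ≤ q)) →
             ApproxRoot n q (if does d then + suc k / suc n else gridRoot n q k)
    select (yes t⁴≤q) = record
      { nonNeg = /-nonNeg (suc k) n
      ; lower  = λ _ → t⁴≤q
      ; upper  = subst (λ t → q < t ⁴) (suc/ (suc k) n) h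
      }
    select (no t⁴≰q) = gridRoot-correct n q k (ℚ.≰⇒> t⁴≰q)

  i≤∣i∣ : ∀ i → i ℤ.≤ + ℤ.∣ i ∣
  i≤∣i∣ (+ _)      = ℤ.≤-refl
  i≤∣i∣ (-[1+ _ ]) = ℤ.-≤+

  approxRoot-correct : ∀ n q → ApproxRoot n q (approxRoot n q)
  approxRoot-correct n q@(mkℚ a d _) =
    gridRoot-correct n q K (ℚ.<-≤-trans q<t (1≤⇒≤⁴ 1≤t))
    where
    K = suc ℤ.∣ a ∣ ℕ.* suc n
    1≤t : 1ℚ ≤ + suc K / suc n
    1≤t = ℚ.toℚᵘ-cancel-≤ (ℚᵘ.≤-respʳ-≃ (ℚᵘ.≃-sym (toℚᵘ-/ (+ suc K) n))
      (ℚᵘ.*≤* (ℤ.+≤+ (ℕ.≤-trans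
        (ℕ.≤-trans (ℕ.≤-reflexive (ℕ.+-identityʳ (suc n))) (ℕ.m≤m+n (suc n) _))
        (ℕ.≤-trans (ℕ.n≤1+n K) (ℕ.≤-reflexive (sym (ℕ.*-identityʳ (suc K)))))))))
    num< : a ℤ.* + suc n ℤ.< + suc K ℤ.* + suc d
    num< = ℤ.≤-<-trans
      (ℤ.*-monoʳ-≤-nonNeg (+ suc n) (i≤∣i∣ a))
      (ℤ.<-≤-trans (ℤ.≤-<-trans (ℤ.≤-reflexive (sym (ℤ.pos-* ℤ.∣ a ∣ (suc n))))
                      (ℤ.+<+ (ℕ.s≤s (ℕ.m≤n+m (ℤ.∣ a ∣ ℕ.* suc n) (suc n)))))
                   (ℤ.+≤+ (ℕ.m≤m*n (suc K) (suc d))))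
    q<t : q < + suc K / suc n
    q<t = ℚ.toℚᵘ-cancel-< (ℚᵘ.<-respʳ-≃ (ℚᵘ.≃-sym (toℚᵘ-/ (+ suc K) n)) (ℚᵘ.*<* num<))

  ApproxRoot-close : ∀ {n m p q r s δ} → 0ℚ < δ →
    ApproxRoot n p r → ApproxRoot m q s → p < q + δ ⁴ →
    r ≤ s + + 1 / suc m + δ
  ApproxRoot-close {n} {m} {p} {q} {r} {s} {δ} 0<δ R S h = ℚ.≮⇒≥ λ lt →
    ℚ.<-irrefl refl (begin-strict
      p              <⟨ h ⟩
      q + δ ⁴        <⟨ ℚ.+-monoˡ-< (δ ⁴) (ApproxRoot.upper S) ⟩
      t ⁴ + δ ⁴      ≤⟨ ⁴-superadd 0≤t (ℚ.<⇒≤ 0<δ) ⟩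
      (t + δ) ⁴      ≤⟨ ⁴-mono 0≤t+δ (ℚ.<⇒≤ lt) ⟩
      r ⁴            ≤⟨ ApproxRoot.lower R (ℚ.≤-<-trans 0≤t+δ lt) ⟩
      p              ∎)
    where
    t = s + + 1 / suc m
    0≤t = nonNeg+nonNeg (ApproxRoot.nonNeg S) (/-nonNeg 1 m)
    0≤t+δ = nonNeg+nonNeg 0≤t (ℚ.<⇒≤ 0<δ)

  half-bound : ∀ s {h ε} → h < ε * ½ → s + h + ε * ½ < s + ε
  half-bound s {h} {ε} h<ε/2 = begin-strict
    s + h + ε * ½        ≡⟨ ℚ.+-assoc s h (ε * ½) ⟩
    s + (h + ε * ½)      <⟨ ℚ.+-monoʳ-< s (ℚ.+-monoˡ-< (ε * ½) h<ε/2) ⟩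
    s + (ε * ½ + ε * ½)  ≡⟨ cong (λ t → s + t) (+-half ε) ⟩
    s + ε                ∎

  expand-⁴ : ∀ p → p * (p * (p * (p * 1ℚ))) ≡ p ⁴
  expand-⁴ p = trans (cong (λ t → p * (p * (p * t))) (ℚ.*-identityʳ p))
                     (sym (ℚ.*-assoc p p (p * p)))

  ApproxRoot-below : ∀ {n q r ε} → 0ℚ < ε → ApproxRoot n q r →
                     0ℚ ≤ q + ε * ½ → r ⁴ < q + ε
  ApproxRoot-below {n} {q} {r} {ε} 0<ε R 0≤q+ε/2 with 0ℚ ℚ.<? r
  ... | yes 0<r = begin-strict
    r ⁴     ≤⟨ ApproxRoot.lower R 0<r ⟩
    q       ≡⟨ sym (ℚ.+-identityʳ q) ⟩
    q + 0ℚ  <⟨ ℚ.+-monoʳ-< q 0<ε ⟩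
    q + ε   ∎
  ... | no 0≮r = begin-strict
    r ⁴                  ≡⟨ cong _⁴ (ℚ.≤-antisym (ℚ.≮⇒≥ 0≮r) (ApproxRoot.nonNeg R)) ⟩
    0ℚ                   ≤⟨ 0≤q+ε/2 ⟩
    q + ε * ½            ≡⟨ sym (ℚ.+-identityʳ _) ⟩
    q + ε * ½ + 0ℚ       <⟨ ℚ.+-monoʳ-< (q + ε * ½) (half-pos 0<ε) ⟩
    q + ε * ½ + ε * ½    ≡⟨ ℚ.+-assoc q (ε * ½) (ε * ½) ⟩
    q + (ε * ½ + ε * ½)  ≡⟨ cong (λ t → q + t) (+-half ε) ⟩
    q + ε                ∎

-- The real numbers as Cauchy sequences of rationals; operations are
-- termwise, equality and order are taken modulo null sequences.

IsCauchy : (ℕ → ℚ) → Set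
IsCauchy x = ∀ ε → 0ℚ ℚ.< ε →
  ∃[ N ] (∀ m n → N ℕ.≤ m → N ℕ.≤ n → ∣ x m ℚ.- x n ∣ ℚ.< ε)

record ℝ : Set where
  constructor mkℝ
  field
    seq    : ℕ → ℚ
    cauchy : IsCauchy seq

open ℝ public

infix 4 _≈_ _≤_

_≈_ : Rel ℝ 0ℓ
x ≈ y = ∀ ε → 0ℚ ℚ.< ε → ∃[ N ] (∀ n → N ℕ.≤ n → ∣ seq x n ℚ.- seq y n ∣ ℚ.< ε)

_≤_ : Rel ℝ 0ℓ
x ≤ y = ∀ ε → 0ℚ ℚ.< ε → ∃[ N ] (∀ n → N ℕ.≤ n → seq x n ℚ.≤ seq y n ℚ.+ ε)

fromℚ : ℚ → ℝ
fromℚ q = mkℝ (λ _ → q) λ ε 0<ε →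
  0 , λ _ _ _ _ → subst (ℚ._< ε) (sym (cong ∣_∣ (ℚ.+-inverseʳ q))) 0<ε

fromℕ : ℕ → ℝ
fromℕ k = fromℚ (+ k ℚ./ 1)

0ℝ 1ℝ : ℝ
0ℝ = fromℚ 0ℚ
1ℝ = fromℚ 1ℚ

infixl 6 _+_
infixl 7 _*_
infixr 8 _^_

_+_ : ℝ → ℝ → ℝ
x + y = mkℝ (λ n → seq x n ℚ.+ seq y n) λ ε 0<ε →
  let (N₁ , h₁) = cauchy x (ε ℚ.* ½) (half-pos 0<ε)
      (N₂ , h₂) = cauchy y (ε ℚ.* ½) (half-pos 0<ε)
  in N₁ ℕ.⊔ N₂ , λ m n N≤m N≤n →
     +-close {a = seq x m} {b = seq y m} {c = seq x n} {d = seq y n}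
       (h₁ m n (ℕ.m⊔n≤o⇒m≤o N₁ N₂ N≤m) (ℕ.m⊔n≤o⇒m≤o N₁ N₂ N≤n))
       (h₂ m n (ℕ.m⊔n≤o⇒n≤o N₁ N₂ N≤m) (ℕ.m⊔n≤o⇒n≤o N₁ N₂ N≤n))

bounded : ∀ x → ∃[ B ] (0ℚ ℚ.< B × ∃[ N ] (∀ n → N ℕ.≤ n → ∣ seq x n ∣ ℚ.< B))
bounded x with cauchy x 1ℚ (ℚ.positive⁻¹ 1ℚ)
... | N , h = B , 0<B , N , bound
  where
  B = ∣ seq x N ∣ ℚ.+ 1ℚ
  0<B : 0ℚ ℚ.< B
  0<B = ℚ.+-mono-≤-< (ℚ.0≤∣p∣ (seq x N)) (ℚ.positive⁻¹ 1ℚ)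
  lem : ∀ p q → p ≡ q ℚ.+ (p ℚ.- q)
  lem = solve 2 (λ p q → p := q :+ (p :- q)) refl
    where open +-*-Solver
  bound : ∀ n → N ℕ.≤ n → ∣ seq x n ∣ ℚ.< B
  bound n N≤n = begin-strict
    ∣ seq x n ∣                            ≡⟨ cong ∣_∣ (lem (seq x n) (seq x N)) ⟩
    ∣ seq x N ℚ.+ (seq x n ℚ.- seq x N) ∣  ≤⟨ ℚ.∣p+q∣≤∣p∣+∣q∣ (seq x N) (seq x n ℚ.- seq x N) ⟩
    ∣ seq x N ∣ ℚ.+ ∣ seq x n ℚ.- seq x N ∣ <⟨ ℚ.+-monoʳ-< ∣ seq x N ∣ (h n N N≤n ℕ.≤-refl) ⟩
    B                                      ∎
    where open ℚ.≤-Reasoning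

commonBound : ∀ x y → ∃[ B ] (0ℚ ℚ.< B × ∃[ N ] (∀ n → N ℕ.≤ n →
              ∣ seq x n ∣ ℚ.< B × ∣ seq y n ∣ ℚ.< B))
commonBound x y =
  let (B₁ , 0<B₁ , N₁ , h₁) = bounded x
      (B₂ , 0<B₂ , N₂ , h₂) = bounded y
  in B₁ ℚ.+ B₂ , ℚ.+-mono-< 0<B₁ 0<B₂ , N₁ ℕ.⊔ N₂ , λ n N≤n →
    ℚ.<-trans (h₁ n (ℕ.m⊔n≤o⇒m≤o N₁ N₂ N≤n))
      (subst (ℚ._< B₁ ℚ.+ B₂) (ℚ.+-identityʳ B₁) (ℚ.+-monoʳ-< B₁ 0<B₂)) ,
    ℚ.<-trans (h₂ n (ℕ.m⊔n≤o⇒n≤o N₁ N₂ N≤n))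
      (subst (ℚ._< B₁ ℚ.+ B₂) (ℚ.+-identityˡ B₂) (ℚ.+-monoˡ-< B₂ 0<B₁))

_*_ : ℝ → ℝ → ℝ
x * y = mkℝ (λ n → seq x n ℚ.* seq y n) λ ε 0<ε →
  let (B , 0<B , N₀ , b) = commonBound x y
      (δ , 0<δ , eq)     = modulus 0<B 0<ε
      (N₁ , h₁)          = cauchy x δ 0<δ
      (N₂ , h₂)          = cauchy y δ 0<δ
      N₁₂                = N₁ ℕ.⊔ N₂
  in N₀ ℕ.⊔ N₁₂ , λ m n N≤m N≤n →
     let (bx , _) = b m (ℕ.m⊔n≤o⇒m≤o N₀ N₁₂ N≤m)
         (_ , by) = b n (ℕ.m⊔n≤o⇒m≤o N₀ N₁₂ N≤n)
         ≤m       = ℕ.m⊔n≤o⇒n≤o N₀ N₁₂ N≤m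
         ≤n       = ℕ.m⊔n≤o⇒n≤o N₀ N₁₂ N≤n
     in subst (∣ seq x m ℚ.* seq y m ℚ.- seq x n ℚ.* seq y n ∣ ℚ.<_) eq
          (*-close {a = seq x m} {b = seq y m} {c = seq x n} {d = seq y n} 0<B bx by
            (h₁ m n (ℕ.m⊔n≤o⇒m≤o N₁ N₂ ≤m) (ℕ.m⊔n≤o⇒m≤o N₁ N₂ ≤n))
            (h₂ m n (ℕ.m⊔n≤o⇒n≤o N₁ N₂ ≤m) (ℕ.m⊔n≤o⇒n≤o N₁ N₂ ≤n)))

_^_ : ℝ → ℕ → ℝ
x ^ zero  = 1ℝ
x ^ suc k = x * x ^ k

∑ ∏ : List ℝ → ℝ
∑ = foldr _+_ 0ℝ
∏ = foldr _*_ 1ℝ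

⁴√-cauchy : ∀ x → IsCauchy (λ n → approxRoot n (seq x n))
⁴√-cauchy x ε 0<ε =
  let 0<δ      = half-pos 0<ε
      (N₁ , h) = cauchy x ((ε ℚ.* ½) ⁴) (⁴-pos 0<δ)
      (N₂ , k) = /-small 0<δ
      close : ∀ m n → N₁ ℕ.⊔ N₂ ℕ.≤ m → N₁ ℕ.⊔ N₂ ℕ.≤ n →
              approxRoot m (seq x m) ℚ.< approxRoot n (seq x n) ℚ.+ ε
      close m n N≤m N≤n = ℚ.≤-<-trans
        (ApproxRoot-close 0<δ (approxRoot-correct m (seq x m)) (approxRoot-correct n (seq x n))
          (abs<⇒<+ (h m n (ℕ.m⊔n≤o⇒m≤o N₁ N₂ N≤m) (ℕ.m⊔n≤o⇒m≤o N₁ N₂ N≤n))))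
        (half-bound (approxRoot n (seq x n)) (k n (ℕ.m⊔n≤o⇒n≤o N₁ N₂ N≤n)))
  in N₁ ℕ.⊔ N₂ , λ m n N≤m N≤n → <+⇒abs< (close m n N≤m N≤n) (close n m N≤n N≤m)

-- total; for x ≥ 0 this is x^(1/4), see ⁴√-nonNeg and ⁴√-correct
⁴√_ : ℝ → ℝ
⁴√ x = mkℝ (λ n → approxRoot n (seq x n)) (⁴√-cauchy x)

*-cong : ∀ {x x′ y y′} → x ≈ x′ → y ≈ y′ → x * y ≈ x′ * y′
*-cong {x} {x′} {y} {y′} x≈x′ y≈y′ ε 0<ε =
  let (B , 0<B , N₀ , b) = commonBound x y′
      (δ , 0<δ , eq)     = modulus 0<B 0<ε
      (N₁ , h₁)          = x≈x′ δ 0<δ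
      (N₂ , h₂)          = y≈y′ δ 0<δ
      N₁₂                = N₁ ℕ.⊔ N₂
  in N₀ ℕ.⊔ N₁₂ , λ n N≤n →
     let (bx , by) = b n (ℕ.m⊔n≤o⇒m≤o N₀ N₁₂ N≤n)
         ≤n        = ℕ.m⊔n≤o⇒n≤o N₀ N₁₂ N≤n
     in subst (∣ seq x n ℚ.* seq y n ℚ.- seq x′ n ℚ.* seq y′ n ∣ ℚ.<_) eq
          (*-close {a = seq x n} {b = seq y n} {c = seq x′ n} {d = seq y′ n} 0<B bx by
            (h₁ n (ℕ.m⊔n≤o⇒m≤o N₁ N₂ ≤n)) (h₂ n (ℕ.m⊔n≤o⇒n≤o N₁ N₂ ≤n)))

⁴√-nonNeg : ∀ x → 0ℝ ≤ ⁴√ x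
⁴√-nonNeg x ε 0<ε = 0 , λ n _ →
  nonNeg+nonNeg (ApproxRoot.nonNeg (approxRoot-correct n (seq x n))) (ℚ.<⇒≤ 0<ε)

ApproxRoot-limit : ∀ x r → (∀ n → ApproxRoot n (seq x n) (seq r n)) →
                   0ℝ ≤ x → r ^ 4 ≈ x
ApproxRoot-limit x r root 0≤x ε 0<ε =
  let (N₁ , h) = *-cong {ρ * ρ} {r * r} {ρ * ρ} {r * r}
                   (*-cong {ρ} {r} {ρ} {r} ρ≈r ρ≈r) (*-cong {ρ} {r} {ρ} {r} ρ≈r ρ≈r) ε 0<ε
      (N₂ , k) = 0≤x (ε ℚ.* ½) (half-pos 0<ε)
  in N₁ ℕ.⊔ N₂ , λ n N≤n →
     subst (λ t → ∣ t ℚ.- seq x n ∣ ℚ.< ε) (sym (expand-⁴ (seq r n)))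
       (<+⇒abs< (ApproxRoot-below 0<ε (root n) (k n (ℕ.m⊔n≤o⇒n≤o N₁ N₂ N≤n)))
                (ℚ.<-trans (ApproxRoot.upper (root n))
                           (abs<⇒<+ (h n (ℕ.m⊔n≤o⇒m≤o N₁ N₂ N≤n)))))
  where
  step : ℝ
  step = mkℝ (λ n → + 1 ℚ./ suc n) λ ε 0<ε →
    let (N , h) = /-small 0<ε
        close : ∀ m n → N ℕ.≤ m → + 1 ℚ./ suc m ℚ.< + 1 ℚ./ suc n ℚ.+ ε
        close m n N≤m = subst (ℚ._< + 1 ℚ./ suc n ℚ.+ ε) (ℚ.+-identityˡ (+ 1 ℚ./ suc m))
                          (ℚ.+-mono-≤-< (/-nonNeg 1 n) (h m N≤m))
    in N , λ m n N≤m N≤n → <+⇒abs< (close m n N≤m) (close n m N≤n)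
  ρ = r + step
  ρ≈r : ρ ≈ r
  ρ≈r ε 0<ε =
    let (N , h) = /-small 0<ε
    in N , λ n N≤n → subst (ℚ._< ε)
         (sym (trans (cong ∣_∣ (cancel (seq r n) (seq step n))) (ℚ.0≤p⇒∣p∣≡p (/-nonNeg 1 n))))
         (h n N≤n)
    where
    open +-*-Solver
    cancel : ∀ p q → (p ℚ.+ q) ℚ.- p ≡ q
    cancel = solve 2 (λ p q → (p :+ q) :- p := q) refl

⁴√-correct : ∀ x → 0ℝ ≤ x → (⁴√ x) ^ 4 ≈ x
⁴√-correct x = ApproxRoot-limit x (⁴√ x) (λ n → approxRoot-correct n (seq x n))

∑ℤ : List ℤ → ℤ
∑ℤ = foldr ℤ._+_ 0ℤ

det : ∀ {n} → (Fin n → Fin n → ℤ) → ℤ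
det {zero}  A = 1ℤ
det {suc n} A = ∑ℤ (map term (allFin (suc n)))
  where
  term : Fin (suc n) → ℤ
  term j = -1ℤ ℤ.^ toℕ j ℤ.* A Fin.zero j ℤ.* det (λ i k → A (Fin.suc i) (punchIn j k))

record Graph (n : ℕ) : Set₁ where
  infix 4 _~_ _~?_
  field
    _~_     : Rel (Fin n) 0ℓ
    _~?_    : Decidable _~_
    ~-sym   : Symmetric _~_
    ~-irref : ∀ {v} → ¬ (v ~ v)

-- for a list without repetitions these are its subsets, each listed once
sublists : ∀ {A : Set} → List A → List (List A)
sublists []       = [] ∷ []
sublists (x ∷ xs) = map (x ∷_) (sublists xs) ++ sublists xs

module _ {n : ℕ} where

  -- an edge {u , v} is represented by the pair (u , v) with u < v
  Pair : Set
  Pair = Fin n × Fin n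

  Incident : Fin n → Pair → Set
  Incident v (a , b) = v ≡ a ⊎ v ≡ b

  incident? : Decidable Incident
  incident? v (a , b) = v Fin.≟ a ⊎-dec v Fin.≟ b

  -- every vertex lies on exactly one edge of M
  IsPerfect : List Pair → Set
  IsPerfect M = ∀ v → length (filter (incident? v) M) ≡ 1

  perfect? : ∀ M → Dec (IsPerfect M)
  perfect? M = Fin.all? λ v → length (filter (incident? v) M) ℕ.≟ 1

  module _ (G : Graph n) where
    open Graph G

    edges : List Pair
    edges = filter (uncurry λ u v → u Fin.<? v ×-dec u ~? v)
                   (cartesianProduct (allFin n) (allFin n))

    perfectMatchings : List (List Pair)
    perfectMatchings = filter perfect? (sublists edges)

    perfmat : ℕ
    perfmat = length perfectMatchings

    neighbours : Fin n → List (Fin n)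
    neighbours v = filter (v ~?_) (allFin n)

    degree : Fin n → ℕ
    degree v = length (neighbours v)

    -- a function E → [0 , ∞); the values of weight at non-edges are never used
    record WeightFunction : Set where
      field
        weight : Fin n → Fin n → ℝ
        symm   : ∀ {u v} → u ~ v → weight u v ≈ weight v u
        nonNeg : ∀ {u v} → u ~ v → 0ℝ ≤ weight u v

    module _ (w : WeightFunction) where
      open WeightFunction w

      perfmatʷ : ℝ
      perfmatʷ = ∑ (map (λ M → ∏ (map (uncurry weight) M)) perfectMatchings)

      -- the weighted degree d_{w,2}
      degree₂ : Fin n → ℝ
      degree₂ v = ∑ (map (λ u → weight u v ^ 2) (neighbours v))

    record Orientation : Set₁ where
      infix 4 _⟶_ _⟶?_
      field
        _⟶_     : Rel (Fin n) 0ℓ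
        _⟶?_    : Decidable _⟶_
        arc⇒edge : ∀ {u v} → u ⟶ v → u ~ v
        edge⇒arc : ∀ {u v} → u ~ v → u ⟶ v ⊎ v ⟶ u
        asym     : Asymmetric _⟶_

      skewAdjacency : Fin n → Fin n → ℤ
      skewAdjacency u v =
        if does (u ⟶? v) then 1ℤ else if does (v ⟶? u) then -1ℤ else 0ℤ

    IsPfaffian : Orientation → Set
    IsPfaffian o = det (Orientation.skewAdjacency o) ≡ (+ perfmat) ℤ.^ 2

    HasPfaffianOrientation : Set₁
    HasPfaffianOrientation = ∃[ o ] IsPfaffian o

∏ᵛ : ∀ {n} → (Fin n → ℝ) → ℝ
∏ᵛ {n} f = ∏ (map f (allFin n))

{-# OPTIONS --safe #-}

-- Let Λ be the exterior algebra on e_1 , … , e_n, let a be skew-symmetric with rows r_k, and put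
-- Q = exp (Σ_{u<v} a(u,v) e_u ∧ e_v). The top coefficient of Q is the pfaffian Pf(a), a signed sum over
-- perfect matchings. If c_k denotes contraction by e_k, then c_k Q = Q (c_k + r_k ∧), so
-- c_1 ⋯ c_n Q = ± Pf(a) · 1 equals Q Ψ, where Ψ = (c_1 + r_1 ∧) ⋯ (c_n + r_n ∧) 1. Hence Ψ = ± Pf(a) Q⁻¹,
-- and the top coefficients give det a = ± Pf(a) Pf(-a).
--
-- For a = S(G) a pfaffian orientation turns this into (Σ ρ)² (Στ)² = perfmat⁴ for signs ρ and τ of the
-- perfect matchings, so both are constant; then (det a)² = (perfmat G_w)⁴ for every symmetric w, where
-- a = (s_uv w_uv). Hadamard's inequality for (det a)² follows from ‖v ∧ ω‖² + ‖c_v ω‖² = ‖v‖² ‖ω‖².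
module Submission where

open import Data.Bool.Base using (Bool; true; false; if_then_else_)
open import Data.Fin.Base as Fin using (Fin; zero; suc; toℕ; punchIn)
import Data.Fin.Properties as Fin
open import Data.Fin.Subset using (Subset; ⊤) renaming (∣_∣ to ∥_∥)
import Data.Fin.Subset.Properties as Subset
open import Data.Integer.Base as ℤ using (ℤ)
import Data.Integer.Properties as ℤ
open import Data.List.Base
  using (List; []; _∷_; _++_; foldr; map; tabulate; allFin; filter; length; cartesianProduct)
import Data.List.Properties as List
open import Data.List.Relation.Unary.All as All using (All; []; _∷_)
import Data.List.Relation.Unary.All.Properties as All
open import Data.Nat.Base as ℕ using (ℕ; zero; suc; s≤s)
open import Data.Nat.Divisibility using (_∣_)
import Data.Nat.Properties as ℕ
open import Data.Product.Base using (_×_; _,_; ∃-syntax; proj₁; proj₂; uncurry)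
import Data.Rational.Properties as ℚ
open import Data.Rational.Solver using (module +-*-Solver)
import Data.Rational.Unnormalised.Base as ℚᵘ
import Data.Rational.Unnormalised.Properties as ℚᵘ
open import Data.Sum.Base using (_⊎_; inj₁; inj₂; [_,_]′)
open import Data.Vec.Base using ([]; _∷_; _[_]≔_; insertAt; lookup)
import Data.Vec.Properties as Vec
import Defs as ℝ
open import Function.Base using (_∘_; id)
open import Relation.Binary.Definitions using (tri<; tri≈; tri>)
open import Relation.Binary.PropositionalEquality
  using (_≡_; _≢_; _≗_; refl; sym; trans; cong; cong₂; subst; module ≡-Reasoning)
open import Relation.Nullary.Decidable using (yes; no)
open import Relation.Nullary.Negation using (¬_; contradiction)
open import Relation.Unary using (Decidable)

-- The classical route to det a = Pf(a)² pairs off permutations by their cycles, whereas `det` is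
-- given by Laplace expansion. Wedge products turn that expansion into the top coefficient of r_1 ∧
-- ⋯ ∧ r_n, and no permutation occurs. Pf(a) and Pf(-a) stay two separate signed sums, and the sign
-- in front is known only through ε² = 1, so the determinant identity is used squared. The signs are
-- constant because (Σ ρ)² and (Σ τ)² are each at most perfmat², so their product reaches perfmat⁴
-- only if both equal perfmat². They depend on the orientation alone, hence what the case w = 1
-- reveals about them is valid for every w. The outcome is a polynomial inequality over the
-- rationals, with fourth powers in place of roots. It can therefore be applied to each term of the
-- Cauchy sequences, and roots enter only in the passage to the limit.

module _ where
  open import Data.Rational.Base
  open import Defs
    using ( ℝ; seq; 0ℝ; fromℕ; ∏ᵛ; ⁴√_; ⁴√-correct; approxRoot-correct; ApproxRoot; _⁴; ⁴-mono; ⁴-superadd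
          ; ⁴-pos; expand-⁴; nonNeg*nonNeg; nonNeg+nonNeg; pos*pos; half-pos; abs<⇒<+; ∣p-q∣≡∣q-p∣; +-close
          ; toℚᵘ-/; ∑ℤ; det; Graph; Orientation; IsPfaffian; sublists; Incident; incident?; IsPerfect
          ; perfect?; edges; perfectMatchings; perfmat; neighbours; degree; WeightFunction; perfmatʷ; degree₂)
  open +-*-Solver

  -- Finite sums over `Fin n`.

  ∑ᶠ ∏ᶠ : ∀ {n} → (Fin n → ℚ) → ℚ
  ∑ᶠ f = foldr _+_ 0ℚ (tabulate f)
  ∏ᶠ f = foldr _*_ 1ℚ (tabulate f)

  ∑ᶠ-cong : ∀ {n} {f g : Fin n → ℚ} → f ≗ g → ∑ᶠ f ≡ ∑ᶠ g
  ∑ᶠ-cong {zero}  f≗g = refl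
  ∑ᶠ-cong {suc n} f≗g = cong₂ _+_ (f≗g zero) (∑ᶠ-cong (f≗g ∘ suc))

  ∑ᶠ-zero : ∀ {n} {f : Fin n → ℚ} → (∀ i → f i ≡ 0ℚ) → ∑ᶠ f ≡ 0ℚ
  ∑ᶠ-zero {zero}  f≗0 = refl
  ∑ᶠ-zero {suc n} f≗0 = cong₂ _+_ (f≗0 zero) (∑ᶠ-zero (f≗0 ∘ suc))

  *-distribˡ-∑ᶠ : ∀ {n} a (f : Fin n → ℚ) → a * ∑ᶠ f ≡ ∑ᶠ (λ i → a * f i)
  *-distribˡ-∑ᶠ {zero}  a f = ℚ.*-zeroʳ a
  *-distribˡ-∑ᶠ {suc n} a f = trans (ℚ.*-distribˡ-+ a _ _) (cong (a * f zero +_) (*-distribˡ-∑ᶠ a (f ∘ suc)))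

  ∑ᶠ-neg : ∀ {n} (f : Fin n → ℚ) → - ∑ᶠ f ≡ ∑ᶠ (λ i → - f i)
  ∑ᶠ-neg {zero}  f = refl
  ∑ᶠ-neg {suc n} f = trans (ℚ.neg-distrib-+ (f zero) _) (cong (- f zero +_) (∑ᶠ-neg (f ∘ suc)))

  -- The exterior algebra

  dot : ∀ {n} → (Fin n → ℚ) → (Fin n → ℚ) → ℚ
  dot u v = ∑ᶠ (λ i → u i * v i)

  -- ω s is the coefficient of the wedge product of the e_i with i ∈ s, taken in increasing order.
  Form : ℕ → Set
  Form n = Subset n → ℚ

  -- Splitting off the first basis vector, ω = ω₀ + e ∧ ω₁ and v = c e + v′, one has v ∧ ω = v′ ∧ ω₀
  -- + e ∧ (c ω₀ - v′ ∧ ω₁): the minus sign comes from moving v′ past e. `contract v` is the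
  -- interior product with v, with the same sign rule.
  wedge contract : ∀ {n} → (Fin n → ℚ) → Form n → Form n
  wedge v ω []          = 0ℚ
  wedge v ω (false ∷ s) = wedge (v ∘ suc) (ω ∘ (false ∷_)) s
  wedge v ω (true ∷ s)  = v zero * ω (false ∷ s) - wedge (v ∘ suc) (ω ∘ (true ∷_)) s
  contract v ω []          = 0ℚ
  contract v ω (false ∷ s) = v zero * ω (true ∷ s) + contract (v ∘ suc) (ω ∘ (false ∷_)) s
  contract v ω (true ∷ s)  = - contract (v ∘ suc) (ω ∘ (true ∷_)) s

  -- Forms are functions compared pointwise, so compatibility with `≗` has to be required as a
  -- field.
  record IsLinear {m n} (L : Form m → Form n) : Set where
    field
      L-cong : ∀ {ω η} → ω ≗ η → L ω ≗ L η
      L-+    : ∀ ω η s → L (λ t → ω t + η t) s ≡ L ω s + L η s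
      L-*    : ∀ a ω s → L (λ t → a * ω t) s ≡ a * L ω s

    L-neg : ∀ ω s → L (λ t → - ω t) s ≡ - L ω s
    L-neg ω s = trans (L-cong (λ t → neg≡ (ω t)) s) (trans (L-* (- 1ℚ) ω s) (sym (neg≡ (L ω s))))
      where
      neg≡ : ∀ p → - p ≡ - 1ℚ * p
      neg≡ = solve 1 (λ p → :- p := con (- 1ℚ) :* p) refl

    L-zero : ∀ {ω} → (∀ s → ω s ≡ 0ℚ) → ∀ s → L ω s ≡ 0ℚ
    L-zero {ω} ω≗0 s = trans (L-cong (λ t → trans (ω≗0 t) (sym (ℚ.*-zeroˡ (ω t)))) s)
                             (trans (L-* 0ℚ ω s) (ℚ.*-zeroˡ (L ω s)))

  open IsLinear

  ∘-linear : ∀ {l m n} {L : Form m → Form n} {K : Form l → Form m} →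
             IsLinear L → IsLinear K → IsLinear (L ∘ K)
  ∘-linear L K = record
    { L-cong = L-cong L ∘ L-cong K
    ; L-+    = λ ω η s → trans (L-cong L (L-+ K ω η) s) (L-+ L _ _ s)
    ; L-*    = λ a ω s → trans (L-cong L (L-* K a ω) s) (L-* L a _ s)
    }

  wedge-linear : ∀ {n} (v : Fin n → ℚ) → IsLinear (wedge v)
  wedge-linear v = record { L-cong = w-cong v ; L-+ = w-+ v ; L-* = w-* v }
    where
    w-cong : ∀ {n} (v : Fin n → ℚ) {ω η} → ω ≗ η → wedge v ω ≗ wedge v η
    w-cong v e []          = refl
    w-cong v e (false ∷ s) = w-cong (v ∘ suc) (e ∘ (false ∷_)) s
    w-cong v e (true ∷ s)  = cong₂ _-_ (cong (v zero *_) (e (false ∷ s))) (w-cong (v ∘ suc) (e ∘ (true ∷_)) s)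
    w-+ : ∀ {n} (v : Fin n → ℚ) ω η s → wedge v (λ t → ω t + η t) s ≡ wedge v ω s + wedge v η s
    w-+ v ω η []          = refl
    w-+ v ω η (false ∷ s) = w-+ (v ∘ suc) _ _ s
    w-+ v ω η (true ∷ s)  = trans (cong (λ z → v zero * (ω (false ∷ s) + η (false ∷ s)) - z) (w-+ (v ∘ suc) _ _ s))
      (solve 5 (λ c x y p q → c :* (x :+ y) :- (p :+ q) := (c :* x :- p) :+ (c :* y :- q)) refl
        (v zero) (ω (false ∷ s)) (η (false ∷ s)) _ _)
    w-* : ∀ {n} (v : Fin n → ℚ) a ω s → wedge v (λ t → a * ω t) s ≡ a * wedge v ω s
    w-* v a ω []          = sym (ℚ.*-zeroʳ a)
    w-* v a ω (false ∷ s) = w-* (v ∘ suc) a _ s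
    w-* v a ω (true ∷ s)  = trans (cong (λ z → v zero * (a * ω (false ∷ s)) - z) (w-* (v ∘ suc) a _ s))
      (solve 4 (λ c a x p → c :* (a :* x) :- a :* p := a :* (c :* x :- p)) refl (v zero) a (ω (false ∷ s)) _)

  contract-linear : ∀ {n} (v : Fin n → ℚ) → IsLinear (contract v)
  contract-linear v = record { L-cong = c-cong v ; L-+ = c-+ v ; L-* = c-* v }
    where
    c-cong : ∀ {n} (v : Fin n → ℚ) {ω η} → ω ≗ η → contract v ω ≗ contract v η
    c-cong v e []          = refl
    c-cong v e (false ∷ s) = cong₂ _+_ (cong (v zero *_) (e (true ∷ s))) (c-cong (v ∘ suc) (e ∘ (false ∷_)) s)
    c-cong v e (true ∷ s)  = cong -_ (c-cong (v ∘ suc) (e ∘ (true ∷_)) s)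
    c-+ : ∀ {n} (v : Fin n → ℚ) ω η s → contract v (λ t → ω t + η t) s ≡ contract v ω s + contract v η s
    c-+ v ω η []          = refl
    c-+ v ω η (false ∷ s) = trans (cong (v zero * (ω (true ∷ s) + η (true ∷ s)) +_) (c-+ (v ∘ suc) _ _ s))
      (solve 5 (λ c x y p q → c :* (x :+ y) :+ (p :+ q) := (c :* x :+ p) :+ (c :* y :+ q)) refl
        (v zero) (ω (true ∷ s)) (η (true ∷ s)) _ _)
    c-+ v ω η (true ∷ s)  = trans (cong -_ (c-+ (v ∘ suc) (ω ∘ (true ∷_)) (η ∘ (true ∷_)) s)) (ℚ.neg-distrib-+ (contract (v ∘ suc) (ω ∘ (true ∷_)) s) _)
    c-* : ∀ {n} (v : Fin n → ℚ) a ω s → contract v (λ t → a * ω t) s ≡ a * contract v ω s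
    c-* v a ω []          = sym (ℚ.*-zeroʳ a)
    c-* v a ω (false ∷ s) = trans (cong (v zero * (a * ω (true ∷ s)) +_) (c-* (v ∘ suc) a _ s))
      (solve 4 (λ c a x p → c :* (a :* x) :+ a :* p := a :* (c :* x :+ p)) refl (v zero) a (ω (true ∷ s)) _)
    c-* v a ω (true ∷ s)  = trans (cong -_ (c-* (v ∘ suc) a _ s)) (ℚ.neg-distribʳ-* a _)

  -- The Clifford relation. With `u = v` it yields the norm identity behind Hadamard's inequality;
  -- with `u = δ k` it moves contractions past the 2-forms e_u ∧ e_v.
  contract-wedge : ∀ {n} (u v : Fin n → ℚ) ω s →
                   contract u (wedge v ω) s + wedge v (contract u ω) s ≡ dot u v * ω s
  contract-wedge u v ω []          = sym (ℚ.*-zeroˡ (ω []))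
  contract-wedge u v ω (false ∷ s) =
    trans (cong (u zero * (v zero * ω (false ∷ s) - wedge v′ ω₁ s) + contract u′ (wedge v′ ω₀) s +_)
            (trans (L-+ (wedge-linear v′) _ _ s) (cong (_+ wedge v′ (contract u′ ω₀) s) (L-* (wedge-linear v′) (u zero) ω₁ s))))
    (trans (solve 6 (λ a b x w p q → a :* (b :* x :- w) :+ p :+ (a :* w :+ q) := a :* b :* x :+ (p :+ q)) refl
             (u zero) (v zero) (ω (false ∷ s)) (wedge v′ ω₁ s) _ _)
    (trans (cong (u zero * v zero * ω (false ∷ s) +_) (contract-wedge u′ v′ ω₀ s))
           (sym (ℚ.*-distribʳ-+ (ω (false ∷ s)) (u zero * v zero) (dot u′ v′)))))
    where
    u′ = u ∘ suc
    v′ = v ∘ suc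
    ω₀ = ω ∘ (false ∷_)
    ω₁ = ω ∘ (true ∷_)
  contract-wedge u v ω (true ∷ s)  =
    trans (cong₂ (λ x y → - x + (v zero * (u zero * ω (true ∷ s) + contract u′ ω₀ s) - y))
            (trans (L-+ (contract-linear u′) _ _ s)
                   (cong₂ _+_ (L-* (contract-linear u′) (v zero) ω₀ s) (L-neg (contract-linear u′) (wedge v′ ω₁) s)))
            (L-neg (wedge-linear v′) (contract u′ ω₁) s))
    (trans (solve 6 (λ a b x c p q → :- (b :* c :+ :- p) :+ (b :* (a :* x :+ c) :- :- q) := a :* b :* x :+ (p :+ q)) refl
             (u zero) (v zero) (ω (true ∷ s)) (contract u′ ω₀ s) _ _)
    (trans (cong (u zero * v zero * ω (true ∷ s) +_) (contract-wedge u′ v′ ω₁ s))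
           (sym (ℚ.*-distribʳ-+ (ω (true ∷ s)) (u zero * v zero) (dot u′ v′)))))
    where
    u′ = u ∘ suc
    v′ = v ∘ suc
    ω₀ = ω ∘ (false ∷_)
    ω₁ = ω ∘ (true ∷_)

  wedge-anticomm : ∀ {n} (u v : Fin n → ℚ) ω s → wedge u (wedge v ω) s ≡ - wedge v (wedge u ω) s
  wedge-anticomm u v ω []          = refl
  wedge-anticomm u v ω (false ∷ s) = wedge-anticomm (u ∘ suc) (v ∘ suc) (ω ∘ (false ∷_)) s
  wedge-anticomm u v ω (true ∷ s)  =
    trans (cong (λ z → u zero * wedge v′ ω₀ s - z) (expand u v))
    (trans (cong (λ x → u zero * wedge v′ ω₀ s - (v zero * wedge u′ ω₀ s - x)) (wedge-anticomm u′ v′ ω₁ s))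
    (trans (solve 5 (λ a p b q r → a :* p :- (b :* q :- :- r) := :- (b :* q :- (a :* p :- r))) refl
             (u zero) (wedge v′ ω₀ s) (v zero) (wedge u′ ω₀ s) (wedge v′ (wedge u′ ω₁) s))
    (cong (λ x → - (v zero * wedge u′ ω₀ s - x)) (sym (expand v u)))))
    where
    u′ = u ∘ suc
    v′ = v ∘ suc
    ω₀ = ω ∘ (false ∷_)
    ω₁ = ω ∘ (true ∷_)
    expand : ∀ u v → wedge (u ∘ suc) (wedge v ω ∘ (true ∷_)) s ≡
                     v zero * wedge (u ∘ suc) ω₀ s - wedge (u ∘ suc) (wedge (v ∘ suc) ω₁) s
    expand u v = trans (L-+ (wedge-linear (u ∘ suc)) _ _ s)
      (cong₂ _+_ (L-* (wedge-linear (u ∘ suc)) (v zero) ω₀ s) (L-neg (wedge-linear (u ∘ suc)) (wedge (v ∘ suc) ω₁) s))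

  p≡-p⇒p≡0 : ∀ {p} → p ≡ - p → p ≡ 0ℚ
  p≡-p⇒p≡0 {p} e = trans (halve p) (trans (cong (λ q → ½ * (p + q)) e) (cancel p))
    where
    halve : ∀ p → p ≡ ½ * (p + p)
    halve = solve 1 (λ p → p := con ½ :* (p :+ p)) refl
    cancel : ∀ p → ½ * (p + - p) ≡ 0ℚ
    cancel = solve 1 (λ p → con ½ :* (p :+ :- p) := con 0ℚ) refl

  wedge-self : ∀ {n} (v : Fin n → ℚ) ω s → wedge v (wedge v ω) s ≡ 0ℚ
  wedge-self v ω s = p≡-p⇒p≡0 (wedge-anticomm v v ω s)

  wedge-congˡ : ∀ {n} {u v : Fin n → ℚ} → u ≗ v → ∀ ω → wedge u ω ≗ wedge v ω
  wedge-congˡ e ω []          = refl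
  wedge-congˡ e ω (false ∷ s) = wedge-congˡ (e ∘ suc) _ s
  wedge-congˡ e ω (true ∷ s)  = cong₂ (λ a x → a * ω (false ∷ s) - x) (e zero) (wedge-congˡ (e ∘ suc) _ s)

  wedge-+ˡ : ∀ {n} (u v : Fin n → ℚ) ω s → wedge (λ i → u i + v i) ω s ≡ wedge u ω s + wedge v ω s
  wedge-+ˡ u v ω []          = refl
  wedge-+ˡ u v ω (false ∷ s) = wedge-+ˡ (u ∘ suc) (v ∘ suc) _ s
  wedge-+ˡ u v ω (true ∷ s)  = trans (cong (λ z → (u zero + v zero) * ω (false ∷ s) - z) (wedge-+ˡ (u ∘ suc) (v ∘ suc) _ s))
    (solve 5 (λ a b x p q → (a :+ b) :* x :- (p :+ q) := a :* x :- p :+ (b :* x :- q)) refl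
      (u zero) (v zero) (ω (false ∷ s)) _ _)

  wedge-*ˡ : ∀ {n} a (v : Fin n → ℚ) ω s → wedge (λ i → a * v i) ω s ≡ a * wedge v ω s
  wedge-*ˡ a v ω []          = sym (ℚ.*-zeroʳ a)
  wedge-*ˡ a v ω (false ∷ s) = wedge-*ˡ a (v ∘ suc) _ s
  wedge-*ˡ a v ω (true ∷ s)  = trans (cong (λ z → a * v zero * ω (false ∷ s) - z) (wedge-*ˡ a (v ∘ suc) _ s))
    (solve 4 (λ a b x p → a :* b :* x :- a :* p := a :* (b :* x :- p)) refl a (v zero) (ω (false ∷ s)) _)

  wedge-zero : ∀ {n} ω (s : Subset n) → wedge (λ _ → 0ℚ) ω s ≡ 0ℚ
  wedge-zero ω s = trans (wedge-*ˡ 0ℚ (λ _ → 0ℚ) ω s) (ℚ.*-zeroˡ (wedge (λ _ → 0ℚ) ω s))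

  p*p≥0 : ∀ p → 0ℚ ≤ p * p
  p*p≥0 p with ℚ.≤-total 0ℚ p
  ... | inj₁ 0≤p = nonNeg*nonNeg 0≤p 0≤p
  ... | inj₂ p≤0 = subst (0ℚ ≤_) (solve 1 (λ p → :- p :* :- p := p :* p) refl p)
                     (nonNeg*nonNeg (ℚ.neg-antimono-≤ p≤0) (ℚ.neg-antimono-≤ p≤0))

  -- Hadamard's inequality

  -- The inner product for which the wedge products of basis vectors are orthonormal; `ω ⊤` is then
  -- a single orthonormal coordinate of ω.
  inner : ∀ {n} → Form n → Form n → ℚ
  inner {zero}  ω η = ω [] * η []
  inner {suc n} ω η = inner (ω ∘ (false ∷_)) (η ∘ (false ∷_)) + inner (ω ∘ (true ∷_)) (η ∘ (true ∷_))

  inner-comm : ∀ {n} (ω η : Form n) → inner ω η ≡ inner η ω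
  inner-comm {zero}  ω η = ℚ.*-comm (ω []) (η [])
  inner-comm {suc n} ω η = cong₂ _+_ (inner-comm (ω ∘ (false ∷_)) (η ∘ (false ∷_)))
                                     (inner-comm (ω ∘ (true ∷_)) (η ∘ (true ∷_)))

  inner-congʳ : ∀ {n} (ω : Form n) {η θ} → η ≗ θ → inner ω η ≡ inner ω θ
  inner-congʳ {zero}  ω e = cong (ω [] *_) (e [])
  inner-congʳ {suc n} ω e = cong₂ _+_ (inner-congʳ _ (e ∘ (false ∷_))) (inner-congʳ _ (e ∘ (true ∷_)))

  inner-+ʳ : ∀ {n} (ω η θ : Form n) → inner ω (λ t → η t + θ t) ≡ inner ω η + inner ω θ
  inner-+ʳ {zero}  ω η θ = ℚ.*-distribˡ-+ (ω []) (η []) (θ [])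
  inner-+ʳ {suc n} ω η θ = trans
    (cong₂ _+_ (inner-+ʳ (ω ∘ (false ∷_)) (η ∘ (false ∷_)) (θ ∘ (false ∷_)))
               (inner-+ʳ (ω ∘ (true ∷_)) (η ∘ (true ∷_)) (θ ∘ (true ∷_))))
    (solve 4 (λ p q r s → p :+ q :+ (r :+ s) := p :+ r :+ (q :+ s)) refl
      (inner (ω ∘ (false ∷_)) (η ∘ (false ∷_))) _ (inner (ω ∘ (true ∷_)) (η ∘ (true ∷_))) _)

  inner-*ʳ : ∀ {n} (ω : Form n) a η → inner ω (λ t → a * η t) ≡ a * inner ω η
  inner-*ʳ {zero}  ω a η = solve 3 (λ w a x → w :* (a :* x) := a :* (w :* x)) refl (ω []) a (η [])
  inner-*ʳ {suc n} ω a η = trans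
    (cong₂ _+_ (inner-*ʳ (ω ∘ (false ∷_)) a (η ∘ (false ∷_))) (inner-*ʳ (ω ∘ (true ∷_)) a (η ∘ (true ∷_))))
    (sym (ℚ.*-distribˡ-+ a _ _))

  inner-negʳ : ∀ {n} (ω η : Form n) → inner ω (λ t → - η t) ≡ - inner ω η
  inner-negʳ {zero}  ω η = sym (ℚ.neg-distribʳ-* (ω []) (η []))
  inner-negʳ {suc n} ω η = trans
    (cong₂ _+_ (inner-negʳ (ω ∘ (false ∷_)) (η ∘ (false ∷_))) (inner-negʳ (ω ∘ (true ∷_)) (η ∘ (true ∷_))))
    (sym (ℚ.neg-distrib-+ (inner (ω ∘ (false ∷_)) (η ∘ (false ∷_))) _))

  inner-nonNeg : ∀ {n} (ω : Form n) → 0ℚ ≤ inner ω ω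
  inner-nonNeg {zero}  ω = p*p≥0 (ω [])
  inner-nonNeg {suc n} ω = nonNeg+nonNeg (inner-nonNeg (ω ∘ (false ∷_))) (inner-nonNeg (ω ∘ (true ∷_)))

  ⊤²≤inner : ∀ {n} (ω : Form n) → ω ⊤ * ω ⊤ ≤ inner ω ω
  ⊤²≤inner {zero}  ω = ℚ.≤-refl
  ⊤²≤inner {suc n} ω = subst (_≤ inner ω ω) (ℚ.+-identityˡ _)
    (ℚ.+-mono-≤ (inner-nonNeg (ω ∘ (false ∷_))) (⊤²≤inner (ω ∘ (true ∷_))))

  wedge-adjoint : ∀ {n} (v : Fin n → ℚ) ω η → inner (wedge v ω) η ≡ inner ω (contract v η)
  wedge-adjoint {zero}  v ω η = trans (ℚ.*-zeroˡ (η [])) (sym (ℚ.*-zeroʳ (ω [])))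
  wedge-adjoint {suc n} v ω η = begin
    inner (wedge v′ ω₀) η₀ + inner (λ s → c * ω₀ s - wedge v′ ω₁ s) η₁
      ≡⟨ cong₂ _+_ (wedge-adjoint v′ ω₀ η₀) (inner-comm (λ s → c * ω₀ s - wedge v′ ω₁ s) η₁) ⟩
    inner ω₀ (contract v′ η₀) + inner η₁ (λ s → c * ω₀ s - wedge v′ ω₁ s)
      ≡⟨ cong (inner ω₀ (contract v′ η₀) +_) (trans (inner-+ʳ η₁ (λ s → c * ω₀ s) (λ s → - wedge v′ ω₁ s))
           (cong (_+ inner η₁ (λ s → - wedge v′ ω₁ s)) (inner-*ʳ η₁ c ω₀))) ⟩
    inner ω₀ (contract v′ η₀) + (c * inner η₁ ω₀ + inner η₁ (λ s → - wedge v′ ω₁ s))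
      ≡⟨ cong (λ z → inner ω₀ (contract v′ η₀) + (c * inner η₁ ω₀ + z)) (inner-negʳ η₁ (wedge v′ ω₁)) ⟩
    inner ω₀ (contract v′ η₀) + (c * inner η₁ ω₀ - inner η₁ (wedge v′ ω₁))
      ≡⟨ cong₂ (λ y z → inner ω₀ (contract v′ η₀) + (c * y - z)) (inner-comm η₁ ω₀)
           (trans (inner-comm η₁ (wedge v′ ω₁)) (wedge-adjoint v′ ω₁ η₁)) ⟩
    inner ω₀ (contract v′ η₀) + (c * inner ω₀ η₁ - inner ω₁ (contract v′ η₁))
      ≡⟨ solve 3 (λ x y z → x :+ (y :- z) := y :+ x :+ :- z) refl
           (inner ω₀ (contract v′ η₀)) (c * inner ω₀ η₁) (inner ω₁ (contract v′ η₁)) ⟩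
    c * inner ω₀ η₁ + inner ω₀ (contract v′ η₀) - inner ω₁ (contract v′ η₁)
      ≡⟨ cong₂ _+_ (trans (inner-+ʳ ω₀ (λ s → c * η₁ s) (contract v′ η₀)) (cong (_+ inner ω₀ (contract v′ η₀)) (inner-*ʳ ω₀ c η₁)))
           (inner-negʳ ω₁ (contract v′ η₁)) ⟨
    inner ω₀ (λ s → c * η₁ s + contract v′ η₀ s) + inner ω₁ (λ s → - contract v′ η₁ s)  ∎
    where
    open ≡-Reasoning
    c = v zero
    v′ = v ∘ suc
    ω₀ = ω ∘ (false ∷_)
    ω₁ = ω ∘ (true ∷_)
    η₀ = η ∘ (false ∷_)
    η₁ = η ∘ (true ∷_)

  -- By adjointness both squared norms become inner products of ω with an image of ω, and the sum of
  -- the two operators is the scalar `dot v v` by the Clifford relation.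
  wedge-lagrange : ∀ {n} (v : Fin n → ℚ) ω →
    inner (wedge v ω) (wedge v ω) + inner (contract v ω) (contract v ω) ≡ dot v v * inner ω ω
  wedge-lagrange v ω = begin
    inner (wedge v ω) (wedge v ω) + inner c c
      ≡⟨ cong₂ _+_ (wedge-adjoint v ω (wedge v ω)) (sym (trans (inner-comm ω (wedge v c)) (wedge-adjoint v c ω))) ⟩
    inner ω (contract v (wedge v ω)) + inner ω (wedge v c)
      ≡⟨ inner-+ʳ ω (contract v (wedge v ω)) (wedge v c) ⟨
    inner ω (λ s → contract v (wedge v ω) s + wedge v c s)
      ≡⟨ inner-congʳ ω (contract-wedge v v ω) ⟩
    inner ω (λ s → dot v v * ω s)
      ≡⟨ inner-*ʳ ω (dot v v) ω ⟩
    dot v v * inner ω ω  ∎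
    where
    open ≡-Reasoning
    c = contract v ω

  one : ∀ {n} → Form n
  one []          = 1ℚ
  one (false ∷ s) = one s
  one (true ∷ s)  = 0ℚ

  inner-one : ∀ n → inner (one {n}) one ≡ 1ℚ
  inner-one zero    = refl
  inner-one (suc n) = trans (cong₂ _+_ (inner-one n) (zeros n)) (ℚ.+-identityʳ 1ℚ)
    where
    zeros : ∀ n → inner {n} (λ _ → 0ℚ) (λ _ → 0ℚ) ≡ 0ℚ
    zeros zero    = refl
    zeros (suc n) = cong₂ _+_ (zeros n) (zeros n)

  compose : ∀ {k n} → (Fin k → Form n → Form n) → Form n → Form n
  compose {zero}  L ω = ω
  compose {suc k} L ω = L zero (compose (L ∘ suc) ω)

  wedges : ∀ {k n} → (Fin k → Fin n → ℚ) → Form n → Form n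
  wedges r = compose (λ i → wedge (r i))

  dot-nonNeg : ∀ {n} (v : Fin n → ℚ) → 0ℚ ≤ dot v v
  dot-nonNeg {zero}  v = ℚ.≤-refl
  dot-nonNeg {suc n} v = nonNeg+nonNeg (p*p≥0 (v zero)) (dot-nonNeg (v ∘ suc))

  wedge-norm : ∀ {n} (v : Fin n → ℚ) ω → inner (wedge v ω) (wedge v ω) ≤ dot v v * inner ω ω
  wedge-norm v ω = begin
    inner (wedge v ω) (wedge v ω)       ≡⟨ ℚ.+-identityʳ _ ⟨
    inner (wedge v ω) (wedge v ω) + 0ℚ  ≤⟨ ℚ.+-monoʳ-≤ (inner (wedge v ω) (wedge v ω)) (inner-nonNeg (contract v ω)) ⟩
    inner (wedge v ω) (wedge v ω) + inner (contract v ω) (contract v ω)  ≡⟨ wedge-lagrange v ω ⟩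
    dot v v * inner ω ω                 ∎
    where open ℚ.≤-Reasoning

  wedges-norm : ∀ {k n} (r : Fin k → Fin n → ℚ) →
                inner (wedges r one) (wedges r one) ≤ ∏ᶠ (λ i → dot (r i) (r i))
  wedges-norm {zero}  {n} r = ℚ.≤-reflexive (inner-one n)
  wedges-norm {suc k} r = ℚ.≤-trans (wedge-norm (r zero) (wedges (r ∘ suc) one))
    (ℚ.*-monoˡ-≤-nonNeg (dot (r zero) (r zero)) {{nonNegative (dot-nonNeg (r zero))}} (wedges-norm (r ∘ suc)))

  hadamard : ∀ {n} (r : Fin n → Fin n → ℚ) →
             wedges r one ⊤ * wedges r one ⊤ ≤ ∏ᶠ (λ i → dot (r i) (r i))
  hadamard r = ℚ.≤-trans (⊤²≤inner (wedges r one)) (wedges-norm r)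

  -- Determinants as wedge products

  ι : ℤ → ℚ
  ι i = i / 1

  ι-+ : ∀ i j → ι (i ℤ.+ j) ≡ ι i + ι j
  ι-+ i j = ℚ.toℚᵘ-injective (ℚᵘ.≃-trans (toℚᵘ-/ (i ℤ.+ j) 0) (ℚᵘ.≃-sym
    (ℚᵘ.≃-trans (ℚ.toℚᵘ-homo-+ (ι i) (ι j)) (ℚᵘ.≃-trans (ℚᵘ.+-cong (toℚᵘ-/ i 0) (toℚᵘ-/ j 0))
    (ℚᵘ.*≡* (cong (ℤ._* ℤ.1ℤ) (cong₂ ℤ._+_ (ℤ.*-identityʳ i) (ℤ.*-identityʳ j))))))))

  ι-* : ∀ i j → ι (i ℤ.* j) ≡ ι i * ι j
  ι-* i j = ℚ.toℚᵘ-injective (ℚᵘ.≃-trans (toℚᵘ-/ (i ℤ.* j) 0) (ℚᵘ.≃-sym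
    (ℚᵘ.≃-trans (ℚ.toℚᵘ-homo-* (ι i) (ι j)) (ℚᵘ.*-cong (toℚᵘ-/ i 0) (toℚᵘ-/ j 0)))))

  ±_ : ∀ {n} → Fin n → ℚ
  ± j = ι (ℤ.-1ℤ ℤ.^ toℕ j)

  ±-suc : ∀ {n} (j : Fin n) → ± (suc j) ≡ - (± j)
  ±-suc j = trans (ι-* ℤ.-1ℤ (ℤ.-1ℤ ℤ.^ toℕ j)) (solve 1 (λ p → con (- 1ℚ) :* p := :- p) refl (± j))

  wedge-⊤ : ∀ {n} (v : Fin n → ℚ) ω → wedge v ω ⊤ ≡ ∑ᶠ (λ j → (± j) * v j * ω (⊤ [ j ]≔ false))
  wedge-⊤ {zero}  v ω = refl
  wedge-⊤ {suc n} v ω = cong₂ _+_ (cong (_* ω (false ∷ ⊤)) (sym (ℚ.*-identityˡ (v zero))))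
    (trans (cong -_ (wedge-⊤ (v ∘ suc) (ω ∘ (true ∷_))))
    (trans (∑ᶠ-neg (λ j → (± j) * v (suc j) * ω (true ∷ ⊤ [ j ]≔ false)))
    (∑ᶠ-cong λ j → trans
      (solve 3 (λ s a x → :- (s :* a :* x) := :- s :* a :* x) refl (± j) (v (suc j)) (ω (true ∷ ⊤ [ j ]≔ false)))
      (cong (λ z → z * v (suc j) * ω (true ∷ ⊤ [ j ]≔ false)) (sym (±-suc j))))))

  -- The quotient map of exterior algebras that kills e_j. It respects wedge products, so it turns a
  -- product of rows into the product of the rows with column j struck out.
  delete : ∀ {n} → Fin (suc n) → Form (suc n) → Form n
  delete j ω s = ω (insertAt s j false)

  wedge-delete : ∀ {n} j (v : Fin (suc n) → ℚ) ω → delete j (wedge v ω) ≗ wedge (v ∘ punchIn j) (delete j ω)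
  wedge-delete zero    v ω s           = refl
  wedge-delete (suc j) v ω (false ∷ s) = wedge-delete j (v ∘ suc) (ω ∘ (false ∷_)) s
  wedge-delete (suc j) v ω (true ∷ s)  =
    cong (λ z → v zero * ω (false ∷ insertAt s j false) - z) (wedge-delete j (v ∘ suc) (ω ∘ (true ∷_)) s)

  delete-one : ∀ {n} (j : Fin (suc n)) → delete j one ≗ one
  delete-one zero    s           = refl
  delete-one (suc j) (false ∷ s) = delete-one j s
  delete-one (suc j) (true ∷ s)  = refl

  wedges-delete : ∀ {k n} j (r : Fin k → Fin (suc n) → ℚ) →
                  delete j (wedges r one) ≗ wedges (λ i → r i ∘ punchIn j) one
  wedges-delete {zero}  j r = delete-one j
  wedges-delete {suc k} j r s = trans (wedge-delete j (r zero) (wedges (r ∘ suc) one) s)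
    (L-cong (wedge-linear (r zero ∘ punchIn j)) (wedges-delete j (r ∘ suc)) s)

  insertAt-⊤ : ∀ {n} (j : Fin (suc n)) → insertAt ⊤ j false ≡ ⊤ [ j ]≔ false
  insertAt-⊤         zero    = refl
  insertAt-⊤ {suc n} (suc j) = cong (true ∷_) (insertAt-⊤ j)

  ι-∑ : ∀ {n} (f : Fin n → ℤ) → ι (∑ℤ (tabulate f)) ≡ ∑ᶠ (ι ∘ f)
  ι-∑ {zero}  f = refl
  ι-∑ {suc n} f = trans (ι-+ (f zero) (∑ℤ (tabulate (f ∘ suc)))) (cong (ι (f zero) +_) (ι-∑ (f ∘ suc)))

  -- Expanding the outermost wedge at `⊤` gives the Laplace expansion along the first row: the
  -- coefficient of the remaining rows at the complement of j is the top coefficient after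
  -- `delete j`, which is the minor.
  det≡wedges : ∀ {n} (A : Fin n → Fin n → ℤ) → ι (det A) ≡ wedges (λ i j → ι (A i j)) one ⊤
  det≡wedges {zero}  A = refl
  det≡wedges {suc n} A = begin
    ι (∑ℤ (map term (allFin (suc n))))  ≡⟨ cong (ι ∘ ∑ℤ) (List.map-tabulate id term) ⟩
    ι (∑ℤ (tabulate term))              ≡⟨ ι-∑ term ⟩
    ∑ᶠ (ι ∘ term)                       ≡⟨ ∑ᶠ-cong expand ⟩
    ∑ᶠ (λ j → (± j) * ι (A zero j) * η (⊤ [ j ]≔ false))  ≡⟨ wedge-⊤ (λ j → ι (A zero j)) η ⟨
    wedges (λ i j → ι (A i j)) one ⊤    ∎
    where
    open ≡-Reasoning
    minor : Fin (suc n) → Fin n → Fin n → ℤ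
    minor j i k = A (suc i) (punchIn j k)
    term : Fin (suc n) → ℤ
    term j = ℤ.-1ℤ ℤ.^ toℕ j ℤ.* A zero j ℤ.* det (minor j)
    η : Form (suc n)
    η = wedges (λ i j → ι (A (suc i) j)) one
    expand : ∀ j → ι (term j) ≡ (± j) * ι (A zero j) * η (⊤ [ j ]≔ false)
    expand j = trans (ι-* (ℤ.-1ℤ ℤ.^ toℕ j ℤ.* A zero j) (det (minor j)))
      (cong₂ _*_ (ι-* (ℤ.-1ℤ ℤ.^ toℕ j) (A zero j))
        (trans (det≡wedges (minor j))
        (trans (sym (wedges-delete j (λ i j → ι (A (suc i) j)) ⊤)) (cong η (insertAt-⊤ j)))))

  -- Determinants and pfaffians

  -- `δ i` is both the basis vector e_i and a row of Kronecker deltas.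
  δ : ∀ {n} → Fin n → Fin n → ℚ
  δ zero    zero    = 1ℚ
  δ zero    (suc j) = 0ℚ
  δ (suc i) zero    = 0ℚ
  δ (suc i) (suc j) = δ i j

  dot-δ : ∀ {n} i (v : Fin n → ℚ) → dot (δ i) v ≡ v i
  dot-δ zero    v = trans (cong₂ _+_ (ℚ.*-identityˡ (v zero)) (∑ᶠ-zero (λ j → ℚ.*-zeroˡ (v (suc j)))))
                         (ℚ.+-identityʳ (v zero))
  dot-δ (suc i) v = trans (cong₂ _+_ (ℚ.*-zeroˡ (v zero)) (dot-δ i (v ∘ suc))) (ℚ.+-identityˡ (v (suc i)))

  -- Products e_u ∧ e_v and the exponential of a 2-form.

  bond : ∀ {n} → Fin n × Fin n → Form n → Form n
  bond (u , v) ω = wedge (δ u) (wedge (δ v) ω)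

  bond-linear : ∀ {n} (e : Fin n × Fin n) → IsLinear (bond e)
  bond-linear (u , v) = ∘-linear (wedge-linear (δ u)) (wedge-linear (δ v))

  -- Moving `w` past e_u and past e_v costs two signs, which cancel.
  bond-wedge : ∀ {n} e (w : Fin n → ℚ) ω → bond e (wedge w ω) ≗ wedge w (bond e ω)
  bond-wedge (u , v) w ω s = begin
    wedge (δ u) (wedge (δ v) (wedge w ω)) s      ≡⟨ L-cong (wedge-linear (δ u)) (wedge-anticomm (δ v) w ω) s ⟩
    wedge (δ u) (λ t → - wedge w (wedge (δ v) ω) t) s  ≡⟨ L-neg (wedge-linear (δ u)) (wedge w (wedge (δ v) ω)) s ⟩
    - wedge (δ u) (wedge w (wedge (δ v) ω)) s    ≡⟨ cong -_ (wedge-anticomm (δ u) w (wedge (δ v) ω) s) ⟩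
    - - wedge w (wedge (δ u) (wedge (δ v) ω)) s  ≡⟨ solve 1 (λ p → :- (:- p) := p) refl _ ⟩
    wedge w (wedge (δ u) (wedge (δ v) ω)) s      ∎
    where open ≡-Reasoning

  wedge-bondˡ : ∀ {n} (u v : Fin n) ω s → wedge (δ u) (bond (u , v) ω) s ≡ 0ℚ
  wedge-bondˡ u v ω = wedge-self (δ u) (wedge (δ v) ω)

  wedge-bondʳ : ∀ {n} (u v : Fin n) ω s → wedge (δ v) (bond (u , v) ω) s ≡ 0ℚ
  wedge-bondʳ u v ω s = trans (sym (bond-wedge (u , v) (δ v) ω s))
    (L-zero (wedge-linear (δ u)) (wedge-self (δ v) ω) s)

  bond-bond : ∀ {n} (e : Fin n × Fin n) ω s → bond e (bond e ω) s ≡ 0ℚ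
  bond-bond (u , v) ω = L-zero (wedge-linear (δ u)) (wedge-bondʳ u v ω)

  -- Multiplication by the exponential of Σ a(u,v) e_u ∧ e_v, as 2-forms commute and e_u ∧ e_v squares to 0.
  gaussian : ∀ {n} → (Fin n × Fin n → ℚ) → List (Fin n × Fin n) → Form n → Form n
  gaussian a []      ω   = ω
  gaussian a (e ∷ E) ω s = gaussian a E ω s + a e * bond e (gaussian a E ω) s

  module _ {n : ℕ} (a : Fin n × Fin n → ℚ) where

    gaussian-linear : ∀ E → IsLinear (gaussian a E)
    gaussian-linear []      = record { L-cong = λ e → e ; L-+ = λ _ _ _ → refl ; L-* = λ _ _ _ → refl }
    gaussian-linear (e ∷ E) = record
      { L-cong = λ ω≗η s → cong₂ (λ x y → x + a e * y) (L-cong G ω≗η s) (L-cong BG ω≗η s)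
      ; L-+    = λ ω η s → trans (cong₂ (λ x y → x + a e * y) (L-+ G ω η s) (L-+ BG ω η s))
          (solve 5 (λ c x y p q → x :+ y :+ c :* (p :+ q) := x :+ c :* p :+ (y :+ c :* q)) refl
            (a e) (gaussian a E ω s) (gaussian a E η s) (bond e (gaussian a E ω) s) (bond e (gaussian a E η) s))
      ; L-*    = λ b ω s → trans (cong₂ (λ x y → x + a e * y) (L-* G b ω s) (L-* BG b ω s))
          (solve 4 (λ c b x p → b :* x :+ c :* (b :* p) := b :* (x :+ c :* p)) refl
            (a e) b (gaussian a E ω s) (bond e (gaussian a E ω) s))
      }
      where
      G = gaussian-linear E
      BG = ∘-linear (bond-linear e) G

    gaussian-wedge : ∀ E w ω → gaussian a E (wedge w ω) ≗ wedge w (gaussian a E ω)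
    gaussian-wedge []      w ω s = refl
    gaussian-wedge (e ∷ E) w ω s = begin
      gaussian a E (wedge w ω) s + a e * bond e (gaussian a E (wedge w ω)) s
        ≡⟨ cong₂ (λ x y → x + a e * y) (gaussian-wedge E w ω s)
             (trans (L-cong (bond-linear e) (gaussian-wedge E w ω) s) (bond-wedge e w η s)) ⟩
      wedge w η s + a e * wedge w (bond e η) s
        ≡⟨ cong (wedge w η s +_) (L-* (wedge-linear w) (a e) (bond e η) s) ⟨
      wedge w η s + wedge w (λ t → a e * bond e η t) s
        ≡⟨ L-+ (wedge-linear w) η (λ t → a e * bond e η t) s ⟨
      wedge w (gaussian a (e ∷ E) ω) s  ∎
      where
      open ≡-Reasoning
      η = gaussian a E ω

    gaussian-bond : ∀ E e ω → gaussian a E (bond e ω) ≗ bond e (gaussian a E ω)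
    gaussian-bond E (u , v) ω s = trans (gaussian-wedge E (δ u) (wedge (δ v) ω) s)
      (L-cong (wedge-linear (δ u)) (gaussian-wedge E (δ v) ω) s)

    -- The contraction of e_u ∧ e_v by e_k, as a vector. Summed with coefficients `a e`, as in
    -- `row`, it is the contraction of the whole 2-form, that is, row k of the skew matrix.
    cross : Fin n → Fin n × Fin n → Fin n → ℚ
    cross k (u , v) j = δ u k * δ v j + (- δ v k) * δ u j

    row : List (Fin n × Fin n) → Fin n → Fin n → ℚ
    row []      k j = 0ℚ
    row (e ∷ E) k j = a e * cross k e j + row E k j

    wedge-cross : ∀ k u v ω s →
      wedge (cross k (u , v)) ω s ≡ δ u k * wedge (δ v) ω s + (- δ v k) * wedge (δ u) ω s
    wedge-cross k u v ω s = trans (wedge-+ˡ (λ j → δ u k * δ v j) (λ j → (- δ v k) * δ u j) ω s)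
      (cong₂ _+_ (wedge-*ˡ (δ u k) (δ v) ω s) (wedge-*ˡ (- δ v k) (δ u) ω s))

    contract-bond : ∀ k e ω s →
      contract (δ k) (bond e ω) s ≡ bond e (contract (δ k) ω) s + wedge (cross k e) ω s
    contract-bond k (u , v) ω s = begin
      contract (δ k) (wedge (δ u) (wedge (δ v) ω)) s
        ≡⟨ move u (wedge (δ v) ω) s ⟩
      δ u k * wedge (δ v) ω s - wedge (δ u) (contract (δ k) (wedge (δ v) ω)) s
        ≡⟨ cong (λ z → δ u k * wedge (δ v) ω s - z) (trans (L-cong W (move v ω) s)
             (trans (L-+ W (λ t → δ v k * ω t) (λ t → - wedge (δ v) (contract (δ k) ω) t) s)
             (cong₂ _+_ (L-* W (δ v k) ω s) (L-neg W (wedge (δ v) (contract (δ k) ω)) s)))) ⟩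
      δ u k * wedge (δ v) ω s - (δ v k * wedge (δ u) ω s - bond (u , v) (contract (δ k) ω) s)
        ≡⟨ solve 5 (λ a b x y z → a :* x :- (b :* y :- z) := z :+ (a :* x :+ :- b :* y)) refl
             (δ u k) (δ v k) (wedge (δ v) ω s) (wedge (δ u) ω s) (bond (u , v) (contract (δ k) ω) s) ⟩
      bond (u , v) (contract (δ k) ω) s + (δ u k * wedge (δ v) ω s + (- δ v k) * wedge (δ u) ω s)
        ≡⟨ cong (bond (u , v) (contract (δ k) ω) s +_) (wedge-cross k u v ω s) ⟨
      bond (u , v) (contract (δ k) ω) s + wedge (cross k (u , v)) ω s  ∎
      where
      open ≡-Reasoning
      W = wedge-linear (δ u)
      move : ∀ u ω s → contract (δ k) (wedge (δ u) ω) s ≡ δ u k * ω s - wedge (δ u) (contract (δ k) ω) s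
      move u ω s = trans
        (solve 2 (λ x y → x := x :+ y :- y) refl _ (wedge (δ u) (contract (δ k) ω) s))
        (cong (_- wedge (δ u) (contract (δ k) ω) s)
          (trans (contract-wedge (δ k) (δ u) ω s) (cong (_* ω s) (dot-δ k (δ u)))))

    -- `cross k e` lies in the span of e_u and e_v, and either of them repeats a factor of e_u ∧
    -- e_v.
    bond-cross : ∀ k e ω s → bond e (wedge (cross k e) ω) s ≡ 0ℚ
    bond-cross k e@(u , v) ω s = begin
      bond e (wedge (cross k e) ω) s  ≡⟨ bond-wedge e (cross k e) ω s ⟩
      wedge (cross k e) (bond e ω) s  ≡⟨ wedge-cross k u v (bond e ω) s ⟩
      δ u k * wedge (δ v) (bond e ω) s + (- δ v k) * wedge (δ u) (bond e ω) s
        ≡⟨ cong₂ (λ x y → δ u k * x + (- δ v k) * y) (wedge-bondʳ u v ω s) (wedge-bondˡ u v ω s) ⟩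
      δ u k * 0ℚ + (- δ v k) * 0ℚ     ≡⟨ solve 2 (λ a b → a :* con 0ℚ :+ :- b :* con 0ℚ := con 0ℚ) refl (δ u k) (δ v k) ⟩
      0ℚ                              ∎
      where open ≡-Reasoning

    -- The conjugate Q⁻¹ c_k Q of the contraction by e_k, as `contract-gaussian` shows.
    dressed : List (Fin n × Fin n) → Fin n → Form n → Form n
    dressed E k ω s = contract (δ k) ω s + wedge (row E k) ω s

    -- For one factor 1 + a B, with B = `bond e` and x = `cross k e`, one has c (1 + a B) = c + a B
    -- c + a x∧ = (1 + a B)(c + a x∧), because B annihilates x∧. The remaining factors commute with
    -- x∧, so the vectors a x add up to `row`.
    contract-gaussian : ∀ E k ω → contract (δ k) (gaussian a E ω) ≗ gaussian a E (dressed E k ω)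
    contract-gaussian []      k ω s = sym (trans
      (cong (contract (δ k) ω s +_) (wedge-zero ω s))
      (ℚ.+-identityʳ _))
    contract-gaussian (e ∷ E) k ω s = begin
      c (λ t → η t + a e * bond e η t) s
        ≡⟨ trans (L-+ C η (λ t → a e * bond e η t) s) (cong (c η s +_) (trans (L-* C (a e) (bond e η) s)
             (cong (a e *_) (contract-bond k e η s)))) ⟩
      c η s + a e * (bond e (c η) s + wedge x η s)
        -- The inserted zero stands for `bond e (wedge x η) s`; with it the right side is (1 + a B)
        -- applied to `H`.
        ≡⟨ solve 4 (λ p a q r → p :+ a :* (q :+ r) := p :+ a :* r :+ a :* (q :+ a :* con 0ℚ)) refl
             (c η s) (a e) (bond e (c η) s) (wedge x η s) ⟩
      c η s + a e * wedge x η s + a e * (bond e (c η) s + a e * 0ℚ)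
        ≡⟨ cong (λ z → c η s + a e * wedge x η s + a e * z) bond-H ⟨
      H s + a e * bond e H s
        ≡⟨ cong₂ (λ y z → y + a e * z) (G-dressed s) (L-cong B G-dressed s) ⟨
      gaussian a E (dressed (e ∷ E) k ω) s + a e * bond e (gaussian a E (dressed (e ∷ E) k ω)) s  ∎
      where
      open ≡-Reasoning
      c = contract (δ k)
      C = contract-linear (δ k)
      B = bond-linear e
      G = gaussian-linear E
      η = gaussian a E ω
      x = cross k e
      H : Form n
      H s = c η s + a e * wedge x η s
      bond-H : bond e H s ≡ bond e (c η) s + a e * 0ℚ
      bond-H = trans (L-+ B (c η) (λ t → a e * wedge x η t) s)
        (cong (bond e (c η) s +_) (trans (L-* B (a e) (wedge x η) s) (cong (a e *_) (bond-cross k e η s))))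
      split : dressed (e ∷ E) k ω ≗ (λ t → dressed E k ω t + a e * wedge x ω t)
      split t = trans
        (cong (c ω t +_) (trans (wedge-+ˡ (λ j → a e * x j) (row E k) ω t)
          (cong (_+ wedge (row E k) ω t) (wedge-*ˡ (a e) x ω t))))
        (solve 3 (λ p q r → p :+ (q :+ r) := p :+ r :+ q) refl (c ω t) (a e * wedge x ω t) (wedge (row E k) ω t))
      G-dressed : gaussian a E (dressed (e ∷ E) k ω) ≗ H
      G-dressed t = trans (L-cong G split t) (trans (L-+ G (dressed E k ω) (λ t → a e * wedge x ω t) t)
        (cong₂ _+_ (sym (contract-gaussian E k ω t))
          (trans (L-* G (a e) (wedge x ω) t) (cong (a e *_) (gaussian-wedge E x ω t)))))

  -- Since `bond e` commutes with all factors and squares to zero, each pair of factors contributes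
  -- (1 - a B)(1 + a B) = 1.
  gaussian-inverse : ∀ {n} (a : Fin n × Fin n → ℚ) E ω → gaussian (-_ ∘ a) E (gaussian a E ω) ≗ ω
  gaussian-inverse a []      ω s = refl
  gaussian-inverse a (e ∷ E) ω s = begin
    G⁻ (gaussian a (e ∷ E) ω) s + (- a e) * bond e (G⁻ (gaussian a (e ∷ E) ω)) s
      ≡⟨ cong₂ (λ x y → x + (- a e) * y) (cancel s) (trans (L-cong B cancel s)
           (trans (L-+ B ω (λ t → a e * bond e ω t) s) (cong (bond e ω s +_)
             (trans (L-* B (a e) (bond e ω) s) (cong (a e *_) (bond-bond e ω s)))))) ⟩
    ω s + a e * bond e ω s + (- a e) * (bond e ω s + a e * 0ℚ)
      ≡⟨ solve 3 (λ x a y → x :+ a :* y :+ :- a :* (y :+ a :* con 0ℚ) := x) refl (ω s) (a e) (bond e ω s) ⟩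
    ω s  ∎
    where
    open ≡-Reasoning
    B = bond-linear e
    G⁻ = gaussian (-_ ∘ a) E
    L⁻ = gaussian-linear (-_ ∘ a) E
    cancel : G⁻ (gaussian a (e ∷ E) ω) ≗ (λ t → ω t + a e * bond e ω t)
    cancel t = trans (L-+ L⁻ (gaussian a E ω) (λ t → a e * bond e (gaussian a E ω) t) t)
      (cong₂ _+_ (gaussian-inverse a E ω t)
        (trans (L-* L⁻ (a e) (bond e (gaussian a E ω)) t) (cong (a e *_)
          (trans (gaussian-bond (-_ ∘ a) E e (gaussian a E ω) t) (L-cong B (gaussian-inverse a E ω) t)))))

  -- Pulls `G` out through the factors one at a time; at each factor `L i` turns into `K i`.
  compose-intertwine : ∀ {k n} {L K : Fin k → Form n → Form n} {G : Form n → Form n} →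
    (∀ i → IsLinear (L i)) → (∀ i ω → L i (G ω) ≗ G (K i ω)) →
    ∀ ω → compose L (G ω) ≗ G (compose K ω)
  compose-intertwine {zero}  lin h ω s = refl
  compose-intertwine {suc k} lin h ω s = trans
    (L-cong (lin zero) (compose-intertwine (lin ∘ suc) (h ∘ suc) ω) s) (h zero _ s)

  -- The product of all contractions, and degree bounds.

  alternating : ℕ → ℚ
  alternating zero    = 1ℚ
  alternating (suc k) = - alternating k

  alternating² : ∀ k → alternating k * alternating k ≡ 1ℚ
  alternating² zero    = refl
  alternating² (suc k) = trans (solve 1 (λ p → :- p :* :- p := p :* p) refl (alternating k)) (alternating² k)

  contract-zero : ∀ {n} ω (s : Subset n) → contract (λ _ → 0ℚ) ω s ≡ 0ℚ
  contract-zero ω []          = refl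
  contract-zero ω (false ∷ s) = trans (cong₂ _+_ (ℚ.*-zeroˡ (ω (true ∷ s))) (contract-zero _ s)) refl
  contract-zero ω (true ∷ s)  = cong -_ (contract-zero _ s)

  -- Each of the k contractions moves past the leading basis vector, which costs one sign.
  contracts-δ-suc : ∀ {k n} (f : Fin k → Fin n) ω s →
    compose (λ i → contract (δ (suc (f i)))) ω (true ∷ s) ≡
    alternating k * compose (λ i → contract (δ (f i))) (ω ∘ (true ∷_)) s
  contracts-δ-suc {zero}  f ω s = sym (ℚ.*-identityˡ _)
  contracts-δ-suc {suc k} f ω s = trans
    (cong -_ (trans (L-cong C (contracts-δ-suc (f ∘ suc) ω) s) (L-* C (alternating k) _ s)))
    (ℚ.neg-distribˡ-* (alternating k) _)
    where C = contract-linear (δ (f zero))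

  -- Contracting by every basis vector kills all coefficients except the top one, which becomes a
  -- constant term. The sign accumulates to (-1)^(n(n-1)/2), of which only the square is recorded.
  contracts-δ : ∀ n → ∃[ ε ] ε * ε ≡ 1ℚ × (∀ (ω : Form n) s → compose (λ k → contract (δ k)) ω s ≡ ε * ω ⊤ * one s)
  contracts-δ zero    = 1ℚ , refl , λ { ω [] → solve 1 (λ x → x := con 1ℚ :* x :* con 1ℚ) refl (ω []) }
  contracts-δ (suc n) with contracts-δ n
  ... | ε , ε²≡1 , h = alternating n * ε ,
    trans (solve 2 (λ x y → x :* y :* (x :* y) := x :* x :* (y :* y)) refl (alternating n) ε)
          (cong₂ _*_ (alternating² n) ε²≡1) ,
    λ { ω (false ∷ s) → trans (cong₂ _+_ (ℚ.*-identityˡ (η ω (true ∷ s))) (contract-zero (η ω ∘ (false ∷_)) s))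
          (trans (ℚ.+-identityʳ (η ω (true ∷ s))) (trans (contracts-δ-suc id ω s)
          (trans (cong (alternating n *_) (h (ω ∘ (true ∷_)) s))
            (solve 4 (λ a e x y → a :* (e :* x :* y) := a :* e :* x :* y) refl
              (alternating n) ε (ω ⊤) (one s)))))
      ; ω (true ∷ s) → trans (cong -_ (contract-zero (η ω ∘ (true ∷_)) s)) (sym (ℚ.*-zeroʳ (alternating n * ε * ω ⊤))) }
    where
    η : Form (suc n) → Form (suc n)
    η = compose (λ k → contract (δ (suc k)))

  -- All components of ω have degree below k, the degree of a basis element being the size of its
  -- subset.
  VanishesFrom : ∀ {n} → ℕ → Form n → Set
  VanishesFrom k ω = ∀ s → k ℕ.≤ ∥ s ∥ → ω s ≡ 0ℚ

  wedge-vanishes : ∀ {n} k (v : Fin n → ℚ) {ω} → VanishesFrom k ω → VanishesFrom (suc k) (wedge v ω)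
  wedge-vanishes zero    v h s           _       = L-zero (wedge-linear v) (λ t → h t ℕ.z≤n) s
  wedge-vanishes (suc k) v h (false ∷ s) k<s     = wedge-vanishes (suc k) (v ∘ suc) (λ t → h (false ∷ t)) s k<s
  wedge-vanishes (suc k) v h (true ∷ s)  (s≤s k≤s) =
    trans (cong₂ (λ x y → v zero * x - y) (h (false ∷ s) k≤s)
            (wedge-vanishes k (v ∘ suc) (λ t k≤t → h (true ∷ t) (s≤s k≤t)) s k≤s))
          (solve 1 (λ p → p :* con 0ℚ :- con 0ℚ := con 0ℚ) refl (v zero))

  contract-vanishes : ∀ {n} k (v : Fin n → ℚ) {ω} → VanishesFrom (suc k) ω → VanishesFrom k (contract v ω)
  contract-vanishes k       v h []          _   = refl
  contract-vanishes k       v h (false ∷ s) k≤s =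
    trans (cong₂ (λ x y → v zero * x + y) (h (true ∷ s) (s≤s k≤s))
            (contract-vanishes k (v ∘ suc) (λ t → h (false ∷ t)) s k≤s))
          (solve 1 (λ p → p :* con 0ℚ :+ con 0ℚ := con 0ℚ) refl (v zero))
  contract-vanishes zero    v h (true ∷ s)  _   =
    cong -_ (L-zero (contract-linear (v ∘ suc)) (λ t → h (true ∷ t) (s≤s ℕ.z≤n)) s)
  contract-vanishes (suc k) v h (true ∷ s)  (s≤s k≤s) =
    cong -_ (contract-vanishes k (v ∘ suc) (λ t k<t → h (true ∷ t) (s≤s k<t)) s k≤s)

  one-vanishes : ∀ {n} → VanishesFrom {n} 1 one
  one-vanishes (false ∷ s) 1≤s = one-vanishes s 1≤s
  one-vanishes (true ∷ s)  _   = refl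

  -- Contractions lower the degree, so they do not contribute to the leading part.
  module _ {n : ℕ} (a : Fin n × Fin n → ℚ) (E : List (Fin n × Fin n)) where

    dressed-leading : ∀ {k} (f : Fin k → Fin n) →
      VanishesFrom (suc k) (compose (dressed a E ∘ f) one) ×
      VanishesFrom k (λ s → compose (dressed a E ∘ f) one s - wedges (row a E ∘ f) one s)
    dressed-leading {zero}  f = one-vanishes , λ s _ → ℚ.+-inverseʳ (one s)
    dressed-leading {suc k} f with dressed-leading (f ∘ suc)
    ... | Ψ-vanishes , Δ-vanishes =
      (λ s k<s → cong₂ _+_ (contract-vanishes (suc (suc k)) (δ (f zero)) (λ t h → Ψ-vanishes t (ℕ.<⇒≤ (ℕ.<⇒≤ h))) s k<s)
                           (wedge-vanishes (suc k) (row a E (f zero)) Ψ-vanishes s k<s)) ,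
      λ s k<s → begin
        contract (δ (f zero)) Ψ s + wedge r Ψ s - wedge r R s
          ≡⟨ ℚ.+-assoc (contract (δ (f zero)) Ψ s) _ _ ⟩
        contract (δ (f zero)) Ψ s + (wedge r Ψ s - wedge r R s)
          ≡⟨ cong (contract (δ (f zero)) Ψ s +_) (trans (L-+ W Ψ (λ t → - R t) s) (cong (wedge r Ψ s +_) (L-neg W R s))) ⟨
        contract (δ (f zero)) Ψ s + wedge r (λ t → Ψ t - R t) s
          -- `Ψ` has degree at most k, so its contraction has degree below k and drops out; this is
          -- why the degree bound is proved together with the comparison of leading parts.
          ≡⟨ cong₂ _+_ (contract-vanishes k (δ (f zero)) Ψ-vanishes s (ℕ.<⇒≤ k<s))
                       (wedge-vanishes k r Δ-vanishes s k<s) ⟩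
        0ℚ  ∎
      where
      open ≡-Reasoning
      r = row a E (f zero)
      W = wedge-linear r
      Ψ = compose (dressed a E ∘ f ∘ suc) one
      R = wedges (row a E ∘ f ∘ suc) one

  pfaffian : ∀ {n} → (Fin n × Fin n → ℚ) → List (Fin n × Fin n) → ℚ
  pfaffian a E = gaussian a E one ⊤

  wedges-row≡pfaffian² : ∀ {n} (a : Fin n × Fin n → ℚ) E →
    ∃[ ε ] ε * ε ≡ 1ℚ × wedges (row a E) one ⊤ ≡ ε * (pfaffian a E * pfaffian (-_ ∘ a) E)
  wedges-row≡pfaffian² {n} a E with contracts-δ n
  ... | ε , ε²≡1 , top = ε , ε²≡1 , (begin
    -- There are n factors and `⊤` has n elements, so `⊤` sees only the leading part of `Ψ`.
    wedges (row a E) one ⊤                            ≡⟨ difference≡0 (proj₂ (dressed-leading a E id) ⊤ (ℕ.≤-reflexive (sym (Subset.∣⊤∣≡n n)))) ⟨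
    Ψ ⊤                                               ≡⟨ gaussian-inverse a E Ψ ⊤ ⟨
    G⁻ (gaussian a E Ψ) ⊤                             ≡⟨ L-cong L⁻ (λ s → sym (intertwine s)) ⊤ ⟩
    G⁻ (compose (λ k → contract (δ k)) (gaussian a E one)) ⊤  ≡⟨ L-cong L⁻ (top (gaussian a E one)) ⊤ ⟩
    G⁻ (λ s → ε * pfaffian a E * one s) ⊤             ≡⟨ L-* L⁻ (ε * pfaffian a E) one ⊤ ⟩
    ε * pfaffian a E * pfaffian (-_ ∘ a) E            ≡⟨ ℚ.*-assoc ε _ _ ⟩
    ε * (pfaffian a E * pfaffian (-_ ∘ a) E)          ∎)
    where
    open ≡-Reasoning
    Ψ = compose (dressed a E) one
    G⁻ = gaussian (-_ ∘ a) E
    L⁻ = gaussian-linear (-_ ∘ a) E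
    intertwine : compose (λ k → contract (δ k)) (gaussian a E one) ≗ gaussian a E Ψ
    intertwine = compose-intertwine (λ k → contract-linear (δ k)) (contract-gaussian a E) one
    difference≡0 : ∀ {p q} → p - q ≡ 0ℚ → p ≡ q
    difference≡0 {p} {q} e = trans (solve 2 (λ p q → p := p :- q :+ q) refl p q) (trans (cong (_+ q) e) (ℚ.+-identityˡ q))

  -- Signs

  IsSign : ℚ → Set
  IsSign p = p ≡ 1ℚ ⊎ p ≡ - 1ℚ

  sign-* : ∀ {p q} → IsSign p → IsSign q → IsSign (p * q)
  sign-* (inj₁ refl) (inj₁ refl) = inj₁ refl
  sign-* (inj₁ refl) (inj₂ refl) = inj₂ refl
  sign-* (inj₂ refl) (inj₁ refl) = inj₂ refl
  sign-* (inj₂ refl) (inj₂ refl) = inj₁ refl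

  sign-neg : ∀ {p} → IsSign p → IsSign (- p)
  sign-neg (inj₁ refl) = inj₂ refl
  sign-neg (inj₂ refl) = inj₁ refl

  sign² : ∀ {p} → IsSign p → p * p ≡ 1ℚ
  sign² (inj₁ refl) = refl
  sign² (inj₂ refl) = refl

  p<q⇒0<q-p : ∀ {p q} → p < q → 0ℚ < q - p
  p<q⇒0<q-p {p} {q} p<q = subst (_< q - p) (ℚ.+-inverseʳ p) (ℚ.+-monoˡ-< (- p) p<q)

  p≤q⇒0≤q-p : ∀ {p q} → p ≤ q → 0ℚ ≤ q - p
  p≤q⇒0≤q-p {p} {q} p≤q = subst (_≤ q - p) (ℚ.+-inverseʳ p) (ℚ.+-monoˡ-≤ (- p) p≤q)

  ≤∧≢⇒< : ∀ {p q} → p ≤ q → p ≢ q → p < q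
  ≤∧≢⇒< p≤q p≢q = ℚ.≰⇒> λ q≤p → p≢q (ℚ.≤-antisym p≤q q≤p)

  -- Sums and products over lists, and extremal sums of signs.

  module _ {A : Set} where

    ∑ˡ ∏ˡ : (A → ℚ) → List A → ℚ
    ∑ˡ f xs = foldr _+_ 0ℚ (map f xs)
    ∏ˡ f xs = foldr _*_ 1ℚ (map f xs)

    ∑ˡ-cong : ∀ {f g : A → ℚ} {xs} → All (λ x → f x ≡ g x) xs → ∑ˡ f xs ≡ ∑ˡ g xs
    ∑ˡ-cong []       = refl
    ∑ˡ-cong (e ∷ es) = cong₂ _+_ e (∑ˡ-cong es)

    ∏ˡ-cong : ∀ {f g : A → ℚ} {xs} → All (λ x → f x ≡ g x) xs → ∏ˡ f xs ≡ ∏ˡ g xs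
    ∏ˡ-cong []       = refl
    ∏ˡ-cong (e ∷ es) = cong₂ _*_ e (∏ˡ-cong es)

    ∑ˡ-++ : ∀ (f : A → ℚ) xs ys → ∑ˡ f (xs ++ ys) ≡ ∑ˡ f xs + ∑ˡ f ys
    ∑ˡ-++ f []       ys = sym (ℚ.+-identityˡ _)
    ∑ˡ-++ f (x ∷ xs) ys = trans (cong (f x +_) (∑ˡ-++ f xs ys)) (sym (ℚ.+-assoc (f x) _ _))

    ∑ˡ-map : ∀ {B : Set} (f : A → ℚ) (g : B → A) xs → ∑ˡ f (map g xs) ≡ foldr _+_ 0ℚ (map (f ∘ g) xs)
    ∑ˡ-map f g xs = cong (foldr _+_ 0ℚ) (sym (List.map-∘ xs))

    *-distribˡ-∑ˡ : ∀ a (f : A → ℚ) xs → a * ∑ˡ f xs ≡ ∑ˡ (λ x → a * f x) xs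
    *-distribˡ-∑ˡ a f []       = ℚ.*-zeroʳ a
    *-distribˡ-∑ˡ a f (x ∷ xs) = trans (ℚ.*-distribˡ-+ a _ _) (cong (a * f x +_) (*-distribˡ-∑ˡ a f xs))

    ∏ˡ-* : ∀ (f g : A → ℚ) xs → ∏ˡ (λ x → f x * g x) xs ≡ ∏ˡ f xs * ∏ˡ g xs
    ∏ˡ-* f g []       = refl
    ∏ˡ-* f g (x ∷ xs) = trans (cong (f x * g x *_) (∏ˡ-* f g xs))
      (solve 4 (λ a b p q → a :* b :* (p :* q) := a :* p :* (b :* q)) refl (f x) (g x) _ _)

    ∏ˡ-sign : ∀ {f : A → ℚ} {xs} → All (IsSign ∘ f) xs → IsSign (∏ˡ f xs)
    ∏ˡ-sign []       = inj₁ refl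
    ∏ˡ-sign (p ∷ ps) = sign-* p (∏ˡ-sign ps)

    ∑ˡ-filter : ∀ {P : A → Set} (P? : Decidable P) {f g : A → ℚ} →
      (∀ x → P x → f x ≡ g x) → (∀ x → ¬ P x → g x ≡ 0ℚ) → ∀ xs → ∑ˡ f (filter P? xs) ≡ ∑ˡ g xs
    ∑ˡ-filter P? {f} {g} on off []       = refl
    ∑ˡ-filter P? {f} {g} on off (x ∷ xs) with P? x
    ... | yes px = cong₂ _+_ (on x px) (∑ˡ-filter P? on off xs)
    ... | no ¬px = trans (∑ˡ-filter P? on off xs) (trans (sym (ℚ.+-identityˡ _)) (cong (_+ ∑ˡ g xs) (sym (off x ¬px))))

    L-∑ˡ : ∀ {m n} {L : Form m → Form n} → IsLinear L → ∀ (c : A → ℚ) (f : A → Form m) xs s →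
           L (λ t → ∑ˡ (λ x → c x * f x t) xs) s ≡ ∑ˡ (λ x → c x * L (f x) s) xs
    L-∑ˡ lin c f []       s = L-zero lin (λ _ → refl) s
    L-∑ˡ lin c f (x ∷ xs) s = trans (L-+ lin (λ t → c x * f x t) _ s)
      (cong₂ _+_ (L-* lin (c x) (f x) s) (L-∑ˡ lin c f xs s))

    sublists-All : ∀ {P : A → Set} {xs} → All P xs → All (All P) (sublists xs)
    sublists-All []       = [] ∷ []
    sublists-All (p ∷ ps) = All.++⁺ (All.map⁺ (All.map (p ∷_) (sublists-All ps))) (sublists-All ps)

    ∑ˡ-sign≤ : ∀ {ρ : A → ℚ} {xs} → All (IsSign ∘ ρ) xs → ∑ˡ ρ xs ≤ ∑ˡ (λ _ → 1ℚ) xs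
    ∑ˡ-sign≤ []               = ℚ.≤-refl
    ∑ˡ-sign≤ (inj₁ e ∷ signs) = ℚ.+-mono-≤ (ℚ.≤-reflexive e) (∑ˡ-sign≤ signs)
    ∑ˡ-sign≤ (inj₂ e ∷ signs) = ℚ.+-mono-≤ (subst (_≤ 1ℚ) (sym e) (*≤* ℤ.-≤+)) (∑ˡ-sign≤ signs)

    maximal⇒all-one : ∀ {ρ : A → ℚ} {xs} → All (IsSign ∘ ρ) xs → ∑ˡ ρ xs ≡ ∑ˡ (λ _ → 1ℚ) xs → All (λ x → ρ x ≡ 1ℚ) xs
    maximal⇒all-one []               _ = []
    maximal⇒all-one {ρ} {x ∷ xs} (inj₁ e ∷ signs) h = e ∷ maximal⇒all-one signs (begin
      ∑ˡ ρ xs                       ≡⟨ solve 1 (λ p → p := con 1ℚ :+ p :- con 1ℚ) refl _ ⟩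
      1ℚ + ∑ˡ ρ xs - 1ℚ             ≡⟨ cong (λ z → z + ∑ˡ ρ xs - 1ℚ) e ⟨
      ρ x + ∑ˡ ρ xs - 1ℚ            ≡⟨ cong (_- 1ℚ) h ⟩
      1ℚ + ∑ˡ (λ _ → 1ℚ) xs - 1ℚ    ≡⟨ solve 1 (λ p → p := con 1ℚ :+ p :- con 1ℚ) refl _ ⟨
      ∑ˡ (λ _ → 1ℚ) xs              ∎)
      where open ≡-Reasoning
    maximal⇒all-one {ρ} {x ∷ xs} (inj₂ e ∷ signs) h = contradiction h (ℚ.<⇒≢
      (ℚ.+-mono-<-≤ (subst (_< 1ℚ) (sym e) (*<* ℤ.-<+)) (∑ˡ-sign≤ signs)))

    Constant : (A → ℚ) → List A → Set
    Constant ρ xs = ∃[ c ] IsSign c × All (λ x → ρ x ≡ c) xs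

    private
      neg-signs : ∀ {ρ : A → ℚ} {xs} → All (IsSign ∘ ρ) xs → All (IsSign ∘ (-_ ∘ ρ)) xs
      neg-signs = All.map sign-neg

    ∑ˡ-neg : ∀ (f : A → ℚ) xs → ∑ˡ (-_ ∘ f) xs ≡ - ∑ˡ f xs
    ∑ˡ-neg f []       = refl
    ∑ˡ-neg f (x ∷ xs) = trans (cong (- f x +_) (∑ˡ-neg f xs)) (sym (ℚ.neg-distrib-+ (f x) (∑ˡ f xs)))

    module _ {ρ : A → ℚ} {xs} (signs : All (IsSign ∘ ρ) xs) where
      private
        N = ∑ˡ (λ _ → 1ℚ) xs
        S = ∑ˡ ρ xs
        S≤N : S ≤ N
        S≤N = ∑ˡ-sign≤ signs
        -S≤N : - S ≤ N
        -S≤N = subst (_≤ N) (∑ˡ-neg ρ xs) (∑ˡ-sign≤ (neg-signs signs))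
        factor : N * N - S * S ≡ (N - S) * (N - - S)
        factor = solve 2 (λ n s → n :* n :- s :* s := (n :- s) :* (n :- :- s)) refl N S

      ∑ˡ-sign²≤ : S * S ≤ N * N
      ∑ˡ-sign²≤ = subst (S * S ≤_) (solve 2 (λ n s → s :* s :+ (n :- s) :* (n :- :- s) := n :* n) refl N S)
        (subst (_≤ S * S + (N - S) * (N - - S)) (ℚ.+-identityʳ (S * S))
          (ℚ.+-monoʳ-≤ (S * S) (nonNeg*nonNeg (p≤q⇒0≤q-p S≤N) (p≤q⇒0≤q-p -S≤N))))

      -- N² - S² factors as (N - S)(N + S) with both factors nonnegative, so S is N or -N; either
      -- extreme forces every single sign.
      ∑ˡ-sign²≡⇒constant : S * S ≡ N * N → Constant ρ xs
      ∑ˡ-sign²≡⇒constant h with S ℚ.≟ N | - S ℚ.≟ N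
      ... | yes e | _     = 1ℚ , inj₁ refl , maximal⇒all-one signs e
      ... | no _  | yes e = - 1ℚ , inj₂ refl ,
        All.map (λ {x} e → trans (solve 1 (λ p → p := :- (:- p)) refl (ρ x)) (cong -_ e))
          (maximal⇒all-one (neg-signs signs) (trans (∑ˡ-neg ρ xs) e))
      ... | no S≢N | no -S≢N = contradiction
        (trans (sym (ℚ.+-inverseʳ (N * N))) (trans (cong (λ z → N * N - z) (sym h)) factor))
        (ℚ.<⇒≢ (pos*pos (p<q⇒0<q-p (≤∧≢⇒< S≤N S≢N)) (p<q⇒0<q-p (≤∧≢⇒< -S≤N -S≢N))))

    -- Both squares are bounded by N², so a strict deficit in the first could not be made up by the
    -- second.
    ∑ˡ-signs-maximal⇒constant : ∀ {ρ τ : A → ℚ} {xs} → All (IsSign ∘ ρ) xs → All (IsSign ∘ τ) xs →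
      let N = ∑ˡ (λ _ → 1ℚ) xs in
      ∑ˡ ρ xs * ∑ˡ ρ xs * (∑ˡ τ xs * ∑ˡ τ xs) ≡ N * N * (N * N) → Constant ρ xs
    ∑ˡ-signs-maximal⇒constant {ρ} {τ} {xs} ρ-signs τ-signs h with ∑ˡ ρ xs * ∑ˡ ρ xs ℚ.≟ N * N
      where N = ∑ˡ (λ _ → 1ℚ) xs
    ... | yes e = ∑ˡ-sign²≡⇒constant ρ-signs e
    ... | no ne = contradiction h (ℚ.<⇒≢ (begin-strict
      R * R * (T * T)  ≤⟨ ℚ.*-monoˡ-≤-nonNeg (R * R) {{nonNegative (p*p≥0 R)}} (∑ˡ-sign²≤ τ-signs) ⟩
      -- Strictness requires N² > 0, which follows from 0 ≤ R² < N²; an empty list thus cannot reach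
      -- this branch.
      R * R * (N * N)  <⟨ ℚ.*-monoˡ-<-pos (N * N) {{positive (ℚ.≤-<-trans (p*p≥0 R) R²<N²)}} R²<N² ⟩
      N * N * (N * N)  ∎))
      where
      open ℚ.≤-Reasoning
      N = ∑ˡ (λ _ → 1ℚ) xs
      R = ∑ˡ ρ xs
      T = ∑ˡ τ xs
      R²<N² = ≤∧≢⇒< (∑ˡ-sign²≤ ρ-signs) ne

    constant-∑ˡ : ∀ {ρ : A → ℚ} {xs} → Constant ρ xs → ∀ f →
      let S = ∑ˡ (λ x → ρ x * f x) xs in S * S ≡ ∑ˡ f xs * ∑ˡ f xs
    constant-∑ˡ {ρ} {xs} (c , c-sign , ρ≡c) f =
      trans (cong (λ z → z * z) (trans (∑ˡ-cong (All.map (λ {x} e → cong (_* f x) e) ρ≡c)) (sym (*-distribˡ-∑ˡ c f xs))))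
      (trans (solve 2 (λ c p → c :* p :* (c :* p) := c :* c :* (p :* p)) refl c (∑ˡ f xs))
      (trans (cong (_* (∑ˡ f xs * ∑ˡ f xs)) (sign² c-sign)) (ℚ.*-identityˡ _)))

  -- Pfaffians and perfect matchings

  -- The coefficient at s of e_u ∧ e_t, where t is s without u: minus one to the number of elements
  -- of s below u if u lies in s, and zero otherwise.
  coeff : ∀ {n} → Fin n → Subset n → ℚ
  coeff zero    (false ∷ s) = 0ℚ
  coeff zero    (true ∷ s)  = 1ℚ
  coeff (suc u) (false ∷ s) = coeff u s
  coeff (suc u) (true ∷ s)  = - coeff u s

  wedge-δ : ∀ {n} (u : Fin n) ω s → wedge (δ u) ω s ≡ coeff u s * ω (s [ u ]≔ false)
  wedge-δ zero    ω (false ∷ s) = trans (wedge-zero (ω ∘ (false ∷_)) s) (sym (ℚ.*-zeroˡ (ω (false ∷ s))))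
  wedge-δ zero    ω (true ∷ s)  = trans (cong (λ z → 1ℚ * ω (false ∷ s) - z) (wedge-zero (ω ∘ (true ∷_)) s)) (ℚ.+-identityʳ _)
  wedge-δ (suc u) ω (false ∷ s) = wedge-δ u (ω ∘ (false ∷_)) s
  wedge-δ (suc u) ω (true ∷ s)  = trans (cong (λ z → 0ℚ * ω (false ∷ s) - z) (wedge-δ u (ω ∘ (true ∷_)) s))
    (solve 3 (λ x a y → con 0ℚ :* x :- a :* y := :- a :* y) refl (ω (false ∷ s)) (coeff u s) _)

  coeff-sign : ∀ {n} (u : Fin n) s → lookup s u ≡ true → IsSign (coeff u s)
  coeff-sign zero    (true ∷ s)  refl = inj₁ refl
  coeff-sign (suc u) (false ∷ s) h    = coeff-sign u s h
  coeff-sign (suc u) (true ∷ s)  h    = sign-neg (coeff-sign u s h)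

  coeff≢0 : ∀ {n} (u : Fin n) s → coeff u s ≢ 0ℚ → lookup s u ≡ true
  coeff≢0 zero    (false ∷ s) h = contradiction refl h
  coeff≢0 zero    (true ∷ s)  h = refl
  coeff≢0 (suc u) (false ∷ s) h = coeff≢0 u s h
  coeff≢0 (suc u) (true ∷ s)  h = coeff≢0 u s (λ e → h (cong -_ e))

  matchingForm : ∀ {n} → List (Fin n × Fin n) → Form n
  matchingForm = foldr bond one

  -- Multiplying out the product of the factors 1 + a(e) `bond e`: each list in `sublists E` records
  -- the factors from which the second summand was chosen.
  gaussian-expand : ∀ {n} a (E : List (Fin n × Fin n)) s →
    gaussian a E one s ≡ ∑ˡ (λ M → ∏ˡ a M * matchingForm M s) (sublists E)
  gaussian-expand a []      s = solve 1 (λ x → x := con 1ℚ :* x :+ con 0ℚ) refl (one s)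
  gaussian-expand a (e ∷ E) s = begin
    gaussian a E one s + a e * bond e (gaussian a E one) s
      ≡⟨ cong₂ (λ x y → x + a e * y) (gaussian-expand a E s)
           (trans (L-cong (bond-linear e) (gaussian-expand a E) s) (L-∑ˡ (bond-linear e) (∏ˡ a) matchingForm (sublists E) s)) ⟩
    ∑ˡ term (sublists E) + a e * ∑ˡ (λ M → ∏ˡ a M * matchingForm (e ∷ M) s) (sublists E)
      ≡⟨ cong (∑ˡ term (sublists E) +_) (*-distribˡ-∑ˡ (a e) _ (sublists E)) ⟩
    ∑ˡ term (sublists E) + ∑ˡ (λ M → a e * (∏ˡ a M * matchingForm (e ∷ M) s)) (sublists E)
      ≡⟨ cong (∑ˡ term (sublists E) +_) (∑ˡ-cong (All.universal (λ M → sym (ℚ.*-assoc (a e) (∏ˡ a M) _)) (sublists E))) ⟩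
    ∑ˡ term (sublists E) + ∑ˡ (term ∘ (e ∷_)) (sublists E)
      ≡⟨ cong (∑ˡ term (sublists E) +_) (∑ˡ-map term (e ∷_) (sublists E)) ⟨
    ∑ˡ term (sublists E) + ∑ˡ term (map (e ∷_) (sublists E))
      ≡⟨ ℚ.+-comm (∑ˡ term (sublists E)) _ ⟩
    ∑ˡ term (map (e ∷_) (sublists E)) + ∑ˡ term (sublists E)
      ≡⟨ ∑ˡ-++ term (map (e ∷_) (sublists E)) (sublists E) ⟨
    ∑ˡ term (sublists (e ∷ E))  ∎
    where
    open ≡-Reasoning
    term : List _ → ℚ
    term M = ∏ˡ a M * matchingForm M s

  bond-coeff : ∀ {n} (u v : Fin n) ω s →
    bond (u , v) ω s ≡ coeff u s * (coeff v (s [ u ]≔ false) * ω (s [ u ]≔ false [ v ]≔ false))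
  bond-coeff u v ω s = trans (wedge-δ u (wedge (δ v) ω) s) (cong (coeff u s *_) (wedge-δ v ω (s [ u ]≔ false)))

  -- Nonzero matching forms and vertex covers.

  bit : Bool → ℕ
  bit b = if b then 1 else 0

  -- Perfection relative to a vertex set s, with vertices outside s left untouched. At `⊤` it is
  -- `IsPerfect`; the general s is needed because peeling off an edge removes its endpoints from the
  -- set.
  Covers : ∀ {n} → List (Fin n × Fin n) → Subset n → Set
  Covers M s = ∀ w → length (filter (incident? w) M) ≡ bit (lookup s w)

  module _ {n : ℕ} where

    lookup-removed : ∀ (s : Subset n) u w → lookup s w ≡ false → lookup (s [ u ]≔ false) w ≡ false
    lookup-removed s u w h with w Fin.≟ u
    ... | yes refl = Vec.lookup∘update u s false
    ... | no w≢u   = trans (Vec.lookup∘update′ w≢u s false) h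

    lookup-remaining : ∀ (s : Subset n) u w → lookup (s [ u ]≔ false) w ≡ true → w ≢ u × lookup s w ≡ true
    lookup-remaining s u w h with w Fin.≟ u
    ... | yes refl = contradiction (trans (sym h) (Vec.lookup∘update u s false)) λ ()
    ... | no w≢u   = w≢u , trans (sym (Vec.lookup∘update′ w≢u s false)) h

    removed-cases : ∀ {u v : Fin n} s → lookup s u ≡ true → lookup (s [ u ]≔ false) v ≡ true → ∀ w →
      (Incident w (u , v) × lookup s w ≡ true × lookup (s [ u ]≔ false [ v ]≔ false) w ≡ false) ⊎
      (¬ Incident w (u , v) × lookup (s [ u ]≔ false [ v ]≔ false) w ≡ lookup s w)
    removed-cases {u} {v} s s∋u s∋v w with w Fin.≟ u | w Fin.≟ v
    ... | yes refl | _        = inj₁ (inj₁ refl , s∋u , lookup-removed (s [ u ]≔ false) v u (Vec.lookup∘update u s false))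
    ... | no _     | yes refl = inj₁ (inj₂ refl , proj₂ (lookup-remaining s u v s∋v) , Vec.lookup∘update v (s [ u ]≔ false) false)
    ... | no w≢u   | no w≢v   = inj₂ ([ w≢u , w≢v ]′ ,
      trans (Vec.lookup∘update′ w≢v (s [ u ]≔ false) false) (Vec.lookup∘update′ w≢u s false))

    module _ {w : Fin n} {e : Fin n × Fin n} {M : List (Fin n × Fin n)} where

      count-incident : Incident w e → length (filter (incident? w) (e ∷ M)) ≡ suc (length (filter (incident? w) M))
      count-incident i = cong length (List.filter-accept (incident? w) i)

      count-nonincident : ¬ Incident w e → length (filter (incident? w) (e ∷ M)) ≡ length (filter (incident? w) M)
      count-nonincident ¬i = cong length (List.filter-reject (incident? w) ¬i)

      covers⇒member : ∀ s → Covers (e ∷ M) s → Incident w e → lookup s w ≡ true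
      covers⇒member s c i with lookup s w | trans (sym (count-incident i)) (c w)
      ... | true | _ = refl

    module _ {u v : Fin n} {M : List (Fin n × Fin n)} (s : Subset n)
             (s∋u : lookup s u ≡ true) (s∋v : lookup (s [ u ]≔ false) v ≡ true) where

      covers-∷⁺ : Covers M (s [ u ]≔ false [ v ]≔ false) → Covers ((u , v) ∷ M) s
      covers-∷⁺ c w with removed-cases s s∋u s∋v w
      ... | inj₁ (i , s∋w , w∉) = trans (count-incident i) (trans (cong suc (trans (c w) (cong bit w∉))) (cong bit (sym s∋w)))
      ... | inj₂ (¬i , same)    = trans (count-nonincident ¬i) (trans (c w) (cong bit same))

      covers-∷⁻ : Covers ((u , v) ∷ M) s → Covers M (s [ u ]≔ false [ v ]≔ false)
      covers-∷⁻ c w with removed-cases s s∋u s∋v w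
      ... | inj₁ (i , s∋w , w∉) = trans (ℕ.suc-injective (trans (sym (count-incident i)) (trans (c w) (cong bit s∋w)))) (cong bit (sym w∉))
      ... | inj₂ (¬i , same)    = trans (sym (count-nonincident ¬i)) (trans (c w) (cong bit (sym same)))

  *≢0⇒≢0ˡ : ∀ {p q} → p * q ≢ 0ℚ → p ≢ 0ℚ
  *≢0⇒≢0ˡ {q = q} h refl = h (ℚ.*-zeroˡ q)

  *≢0⇒≢0ʳ : ∀ {p q} → p * q ≢ 0ℚ → q ≢ 0ℚ
  *≢0⇒≢0ʳ {p} h refl = h (ℚ.*-zeroʳ p)

  one≢0⇒empty : ∀ {n} (s : Subset n) → one s ≢ 0ℚ → ∀ w → lookup s w ≡ false
  one≢0⇒empty (false ∷ s) h zero    = refl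
  one≢0⇒empty (false ∷ s) h (suc w) = one≢0⇒empty s h w
  one≢0⇒empty (true ∷ s)  h         = contradiction refl h

  one-empty : ∀ {n} (s : Subset n) → (∀ w → lookup s w ≡ false) → one s ≡ 1ℚ
  one-empty []          h = refl
  one-empty (false ∷ s) h = one-empty s (h ∘ suc)
  one-empty (true ∷ s)  h = contradiction (h zero) λ ()

  -- A nonzero product has nonzero factors, so both endpoints of the first edge still lie in the set
  -- when they are removed, and the rest of the list inherits nonvanishing.
  matchingForm≢0⇒covers : ∀ {n} M (s : Subset n) → matchingForm M s ≢ 0ℚ → Covers M s
  matchingForm≢0⇒covers []            s h w = cong bit (sym (one≢0⇒empty s h w))
  matchingForm≢0⇒covers ((u , v) ∷ M) s h = covers-∷⁺ {M = M} s
    (coeff≢0 u s (*≢0⇒≢0ˡ h′)) (coeff≢0 v (s [ u ]≔ false) (*≢0⇒≢0ˡ (*≢0⇒≢0ʳ {coeff u s} h′)))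
    (matchingForm≢0⇒covers M _ (*≢0⇒≢0ʳ {coeff v (s [ u ]≔ false)} (*≢0⇒≢0ʳ {coeff u s} h′)))
    where
    h′ : coeff u s * (coeff v (s [ u ]≔ false) * matchingForm M (s [ u ]≔ false [ v ]≔ false)) ≢ 0ℚ
    h′ e = h (trans (bond-coeff u v (matchingForm M) s) e)

  -- Every factor met while peeling off edges is a sign. Looplessness matters: a loop is counted
  -- once by `Covers` but annihilated by `bond`, and u ≢ v is what keeps v in the set after u is
  -- removed.
  covers⇒sign : ∀ {n} M (s : Subset n) → All (uncurry _≢_) M → Covers M s → IsSign (matchingForm M s)
  covers⇒sign []            s []          c = inj₁ (one-empty s λ w → bit-injective (sym (c w)))
    where
    bit-injective : ∀ {b} → bit b ≡ 0 → b ≡ false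
    bit-injective {false} _ = refl
  covers⇒sign ((u , v) ∷ M) s (u≢v ∷ loopless) c =
    subst IsSign (sym (bond-coeff u v (matchingForm M) s))
      (sign-* (coeff-sign u s s∋u) (sign-* (coeff-sign v (s [ u ]≔ false) s′∋v)
        (covers⇒sign M _ loopless (covers-∷⁻ {M = M} s s∋u s′∋v c))))
    where
    s∋u : lookup s u ≡ true
    s∋u = covers⇒member {M = M} s c (inj₁ refl)
    s′∋v : lookup (s [ u ]≔ false) v ≡ true
    s′∋v = trans (Vec.lookup∘update′ (u≢v ∘ sym) s false) (covers⇒member {M = M} s c (inj₂ refl))

  -- Counting, and sums over pairs.

  ι-length : ∀ {A : Set} (xs : List A) → ι (ℤ.+ length xs) ≡ ∑ˡ (λ _ → 1ℚ) xs
  ι-length []       = refl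
  ι-length (x ∷ xs) = trans (ι-+ (ℤ.+ 1) (ℤ.+ length xs)) (cong (1ℚ +_) (ι-length xs))

  ∏ˡ-one : ∀ {A : Set} (xs : List A) → ∏ˡ (λ _ → 1ℚ) xs ≡ 1ℚ
  ∏ˡ-one []       = refl
  ∏ˡ-one (x ∷ xs) = trans (ℚ.*-identityˡ _) (∏ˡ-one xs)

  ∑ˡ-allFin : ∀ {n} (f : Fin n → ℚ) → ∑ˡ f (allFin n) ≡ ∑ᶠ f
  ∑ˡ-allFin f = cong (foldr _+_ 0ℚ) (List.map-tabulate id f)

  ∑ᶠ-+ : ∀ {n} (f g : Fin n → ℚ) → ∑ᶠ (λ i → f i + g i) ≡ ∑ᶠ f + ∑ᶠ g
  ∑ᶠ-+ {zero}  f g = refl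
  ∑ᶠ-+ {suc n} f g = trans (cong (f zero + g zero +_) (∑ᶠ-+ (f ∘ suc) (g ∘ suc)))
    (solve 4 (λ a b p q → a :+ b :+ (p :+ q) := a :+ p :+ (b :+ q)) refl (f zero) (g zero) _ _)

  ∑ˡ-cartesianProduct : ∀ {n} {A : Set} (f : A × Fin n → ℚ) xs →
    ∑ˡ f (cartesianProduct xs (allFin n)) ≡ ∑ˡ (λ x → ∑ᶠ (λ j → f (x , j))) xs
  ∑ˡ-cartesianProduct         f []       = refl
  ∑ˡ-cartesianProduct {n} f (x ∷ xs) = trans (∑ˡ-++ f (map (x ,_) (allFin n)) _)
    (cong₂ _+_ (trans (∑ˡ-map f (x ,_) (allFin n)) (∑ˡ-allFin (λ j → f (x , j)))) (∑ˡ-cartesianProduct f xs))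

  δ-sym : ∀ {n} (i j : Fin n) → δ i j ≡ δ j i
  δ-sym zero    zero    = refl
  δ-sym zero    (suc j) = refl
  δ-sym (suc i) zero    = refl
  δ-sym (suc i) (suc j) = δ-sym i j

  row-∑ˡ : ∀ {n} (a : Fin n × Fin n → ℚ) E k j → row a E k j ≡ ∑ˡ (λ e → a e * cross a k e j) E
  row-∑ˡ a []      k j = refl
  row-∑ˡ a (e ∷ E) k j = cong (a e * cross a k e j +_) (row-∑ˡ a E k j)

  ∑ᶠ∑ᶠ-δ : ∀ {n} (g : Fin n → Fin n → ℚ) k j →
    ∑ᶠ (λ u → ∑ᶠ (λ v → g u v * (δ u k * δ v j + (- δ v k) * δ u j))) ≡ g k j - g j k
  ∑ᶠ∑ᶠ-δ g k j = begin
    ∑ᶠ (λ u → ∑ᶠ (λ v → g u v * (δ u k * δ v j + (- δ v k) * δ u j)))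
      ≡⟨ ∑ᶠ-cong inner-sum ⟩
    ∑ᶠ (λ u → δ k u * g u j + δ j u * - g u k)
      ≡⟨ ∑ᶠ-+ (λ u → δ k u * g u j) (λ u → δ j u * - g u k) ⟩
    dot (δ k) (λ u → g u j) + dot (δ j) (λ u → - g u k)
      ≡⟨ cong₂ _+_ (dot-δ k (λ u → g u j)) (dot-δ j (λ u → - g u k)) ⟩
    g k j - g j k  ∎
    where
    open ≡-Reasoning
    inner-sum : ∀ u → ∑ᶠ (λ v → g u v * (δ u k * δ v j + (- δ v k) * δ u j)) ≡ δ k u * g u j + δ j u * - g u k
    inner-sum u = begin
      ∑ᶠ (λ v → g u v * (δ u k * δ v j + (- δ v k) * δ u j))
        ≡⟨ ∑ᶠ-cong (λ v → trans
             (solve 5 (λ g a b c d → g :* (a :* b :+ :- c :* d) := a :* (b :* g) :+ d :* (c :* :- g)) refl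
               (g u v) (δ u k) (δ v j) (δ v k) (δ u j))
             (cong₂ _+_ (cong₂ (λ x y → x * (y * g u v)) (δ-sym u k) (δ-sym v j))
                        (cong₂ (λ x y → x * (y * - g u v)) (δ-sym u j) (δ-sym v k)))) ⟩
      ∑ᶠ (λ v → δ k u * (δ j v * g u v) + δ j u * (δ k v * - g u v))
        ≡⟨ ∑ᶠ-+ (λ v → δ k u * (δ j v * g u v)) (λ v → δ j u * (δ k v * - g u v)) ⟩
      ∑ᶠ (λ v → δ k u * (δ j v * g u v)) + ∑ᶠ (λ v → δ j u * (δ k v * - g u v))
        ≡⟨ cong₂ _+_ (*-distribˡ-∑ᶠ (δ k u) (λ v → δ j v * g u v)) (*-distribˡ-∑ᶠ (δ j u) (λ v → δ k v * - g u v)) ⟨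
      δ k u * dot (δ j) (g u) + δ j u * dot (δ k) (λ v → - g u v)
        ≡⟨ cong₂ (λ x y → δ k u * x + δ j u * y) (dot-δ j (g u)) (dot-δ k (λ v → - g u v)) ⟩
      δ k u * g u j + δ j u * - g u k  ∎

  wedges-cong : ∀ {k n} {r r′ : Fin k → Fin n → ℚ} → (∀ i → r i ≗ r′ i) → ∀ ω → wedges r ω ≗ wedges r′ ω
  wedges-cong {zero}      e ω s = refl
  wedges-cong {suc k} {r = r} {r′} e ω s =
    trans (L-cong (wedge-linear (r zero)) (wedges-cong (e ∘ suc) ω) s) (wedge-congˡ (e zero) (wedges (r′ ∘ suc) ω) s)

  -- Perfect matchings and skew matrices of a graph.

  module _ {n : ℕ} (G : Graph n) where
    open Graph G

    Edge : Fin n × Fin n → Set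
    Edge (u , v) = u Fin.< v × u ~ v

    edges-All : All Edge (edges G)
    edges-All = All.all-filter _ (cartesianProduct (allFin n) (allFin n))

    perfectMatchings-All : All (λ M → IsPerfect M × All Edge M) (perfectMatchings G)
    perfectMatchings-All = All.zip
      (All.all-filter perfect? (sublists (edges G)) , All.filter⁺ perfect? (sublists-All edges-All))

    perfect⇒covers : ∀ M → IsPerfect {n} M → Covers M ⊤
    perfect⇒covers M p w = trans (p w) (cong bit (sym (Vec.lookup-replicate w true)))

    covers⇒perfect : ∀ M → Covers {n} M ⊤ → IsPerfect M
    covers⇒perfect M c w = trans (c w) (cong bit (Vec.lookup-replicate w true))

    -- In the expansion over all sublists of edges, a list that is not a perfect matching has
    -- vanishing top coefficient.
    pfaffian-∑ˡ : ∀ a → pfaffian a (edges G) ≡ ∑ˡ (λ M → ∏ˡ a M * matchingForm M ⊤) (perfectMatchings G)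
    pfaffian-∑ˡ a = trans (gaussian-expand a (edges G) ⊤)
      (sym (∑ˡ-filter perfect? (λ _ _ → refl) vanish (sublists (edges G))))
      where
      vanish : ∀ M → ¬ IsPerfect M → ∏ˡ a M * matchingForm M ⊤ ≡ 0ℚ
      vanish M ¬p with matchingForm M ⊤ ℚ.≟ 0ℚ
      ... | yes e = trans (cong (∏ˡ a M *_) e) (ℚ.*-zeroʳ (∏ˡ a M))
      ... | no ne = contradiction (covers⇒perfect M (matchingForm≢0⇒covers M ⊤ ne)) ¬p

    -- Each edge is listed once, as a pair u < v. The sum is extended to all pairs through the
    -- strictly upper triangular part g of A; the sum of crosses then gives g minus its transpose,
    -- which is A by skewness.
    row-edges : (A : Fin n → Fin n → ℚ) → (∀ u v → A u v ≡ - A v u) → (∀ u v → ¬ (u ~ v) → A u v ≡ 0ℚ) →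
                ∀ k j → row (uncurry A) (edges G) k j ≡ A k j
    row-edges A skew off k j = begin
      row a (edges G) k j                       ≡⟨ row-∑ˡ a (edges G) k j ⟩
      ∑ˡ (λ e → a e * cross a k e j) (edges G)  ≡⟨ ∑ˡ-filter _ on vanish pairs ⟩
      ∑ˡ (λ e → uncurry g e * cross a k e j) pairs
        ≡⟨ ∑ˡ-cartesianProduct (λ e → uncurry g e * cross a k e j) (allFin n) ⟩
      ∑ˡ (λ u → ∑ᶠ (λ v → g u v * cross a k (u , v) j)) (allFin n)
        ≡⟨ ∑ˡ-allFin (λ u → ∑ᶠ (λ v → g u v * cross a k (u , v) j)) ⟩
      ∑ᶠ (λ u → ∑ᶠ (λ v → g u v * cross a k (u , v) j))  ≡⟨ ∑ᶠ∑ᶠ-δ g k j ⟩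
      g k j - g j k                             ≡⟨ difference ⟩
      A k j                                     ∎
      where
      open ≡-Reasoning
      a : Fin n × Fin n → ℚ
      a = uncurry A
      pairs : List (Fin n × Fin n)
      pairs = cartesianProduct (allFin n) (allFin n)
      g : Fin n → Fin n → ℚ
      g u v with u Fin.<? v
      ... | yes _ = A u v
      ... | no  _ = 0ℚ
      g-< : ∀ {u v} → u Fin.< v → g u v ≡ A u v
      g-< {u} {v} u<v with u Fin.<? v
      ... | yes _   = refl
      ... | no  u≮v = contradiction u<v u≮v
      g-≮ : ∀ {u v} → ¬ (u Fin.< v) → g u v ≡ 0ℚ
      g-≮ {u} {v} u≮v with u Fin.<? v
      ... | yes u<v = contradiction u<v u≮v
      ... | no  _   = refl
      on : ∀ e → Edge e → a e * cross a k e j ≡ uncurry g e * cross a k e j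
      on e (u<v , _) = cong (_* cross a k e j) (sym (g-< u<v))
      vanish : ∀ e → ¬ Edge e → uncurry g e * cross a k e j ≡ 0ℚ
      vanish e@(u , v) ¬edge = trans (cong (_* cross a k e j) g≡0) (ℚ.*-zeroˡ (cross a k e j))
        where
        g≡0 : g u v ≡ 0ℚ
        g≡0 with u Fin.<? v
        ... | yes u<v = off u v (λ u~v → ¬edge (u<v , u~v))
        ... | no  _   = refl
      difference : g k j - g j k ≡ A k j
      difference with Fin.<-cmp k j
      ... | tri< k<j _ j≮k = trans (cong₂ _-_ (g-< k<j) (g-≮ j≮k)) (ℚ.+-identityʳ (A k j))
      -- On the diagonal g - g vanishes, and so does A, being equal to its own negative.
      ... | tri≈ k≮j refl _ = trans (ℚ.+-inverseʳ (g k k)) (sym (p≡-p⇒p≡0 (skew k k)))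
      ... | tri> k≮j _ j<k = trans (cong₂ _-_ (g-≮ k≮j) (g-< j<k))
        (trans (ℚ.+-identityˡ (- A j k)) (sym (skew k j)))

    module _ (o : Orientation G) where
      open Orientation o

      S : Fin n → Fin n → ℚ
      S u v = ι (skewAdjacency u v)

      S-skew : ∀ u v → S u v ≡ - S v u
      S-skew u v with u ⟶? v | v ⟶? u
      ... | yes p | yes q = contradiction q (asym p)
      ... | yes _ | no _  = refl
      ... | no _  | yes _ = refl
      ... | no _  | no _  = refl

      S-nonedge : ∀ u v → ¬ (u ~ v) → S u v ≡ 0ℚ
      S-nonedge u v ¬e with u ⟶? v | v ⟶? u
      ... | yes p | _     = contradiction (arc⇒edge p) ¬e
      ... | no _  | yes q = contradiction (~-sym (arc⇒edge q)) ¬e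
      ... | no _  | no _  = refl

      S-sign : ∀ {u v} → u ~ v → IsSign (S u v)
      S-sign {u} {v} e with u ⟶? v | v ⟶? u
      ... | yes _ | _     = inj₁ refl
      ... | no _  | yes _ = inj₂ refl
      ... | no ¬p | no ¬q = contradiction (edge⇒arc e) λ { (inj₁ p) → ¬p p ; (inj₂ q) → ¬q q }

      -- For sign-valued σ, this is the sign with which the matching M enters the pfaffian of σ.
      signed : (Fin n × Fin n → ℚ) → List (Fin n × Fin n) → ℚ
      signed σ M = ∏ˡ σ M * matchingForm M ⊤

      signed-sign : ∀ {σ} → (∀ {e} → Edge e → IsSign (σ e)) → All (IsSign ∘ signed σ) (perfectMatchings G)
      signed-sign σ-sign = All.map (λ {M} (perfect , M-edges) → sign-*
        (∏ˡ-sign (All.map σ-sign M-edges))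
        (covers⇒sign M ⊤ (All.map (λ (u<v , _) → Fin.<⇒≢ u<v) M-edges) (perfect⇒covers M perfect)))
        perfectMatchings-All

      ρ τ : List (Fin n × Fin n) → ℚ
      ρ = signed (uncurry S)
      τ = signed (-_ ∘ uncurry S)

      ρ-signs : All (IsSign ∘ ρ) (perfectMatchings G)
      ρ-signs = signed-sign λ (_ , u~v) → S-sign u~v

      τ-signs : All (IsSign ∘ τ) (perfectMatchings G)
      τ-signs = signed-sign λ (_ , u~v) → sign-neg (S-sign u~v)

      module _ (w : Fin n → Fin n → ℚ) (w-sym : ∀ u v → w u v ≡ w v u) where

        A : Fin n → Fin n → ℚ
        A u v = S u v * w u v

        matchingWeight : List (Fin n × Fin n) → ℚ
        matchingWeight = ∏ˡ (uncurry w)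

        rows≡A : ∀ k j → row (uncurry A) (edges G) k j ≡ A k j
        rows≡A = row-edges A
          (λ u v → trans (cong₂ _*_ (S-skew u v) (w-sym u v)) (sym (ℚ.neg-distribˡ-* (S v u) (w v u))))
          (λ u v ¬e → trans (cong (_* w u v) (S-nonedge u v ¬e)) (ℚ.*-zeroˡ (w u v)))

        signed-* : ∀ σ b → (∀ e → b e ≡ σ e * uncurry w e) →
                   pfaffian b (edges G) ≡ ∑ˡ (λ M → signed σ M * matchingWeight M) (perfectMatchings G)
        signed-* σ b e = trans (pfaffian-∑ˡ b) (∑ˡ-cong (All.universal
          (λ M → trans (cong (_* matchingForm M ⊤) (trans (∏ˡ-cong (All.universal e M)) (∏ˡ-* σ (uncurry w) M)))
            (solve 3 (λ x y z → x :* y :* z := x :* z :* y) refl (∏ˡ σ M) (matchingWeight M) (matchingForm M ⊤)))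
          (perfectMatchings G)))

        -- Squaring removes the unknown ε. The negated matrix is (-S) times w entrywise, so Pf(-A)
        -- has the signs τ; neither ρ nor τ involves w.
        wedges-A² : let P = ∑ˡ (λ M → ρ M * matchingWeight M) (perfectMatchings G)
                        Q = ∑ˡ (λ M → τ M * matchingWeight M) (perfectMatchings G)
                        D = wedges A one ⊤
                    in D * D ≡ P * P * (Q * Q)
        wedges-A² = let (ε , ε²≡1 , e) = wedges-row≡pfaffian² (uncurry A) (edges G) in begin
          D * D                  ≡⟨ cong (λ z → z * z) (trans (wedges-cong (λ k j → sym (rows≡A k j)) one ⊤) e) ⟩
          ε * (pf⁺ * pf⁻) * (ε * (pf⁺ * pf⁻))
            ≡⟨ solve 3 (λ ε x y → ε :* (x :* y) :* (ε :* (x :* y)) := ε :* ε :* (x :* x :* (y :* y))) refl ε pf⁺ pf⁻ ⟩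
          ε * ε * (pf⁺ * pf⁺ * (pf⁻ * pf⁻))  ≡⟨ cong (_* (pf⁺ * pf⁺ * (pf⁻ * pf⁻))) ε²≡1 ⟩
          1ℚ * (pf⁺ * pf⁺ * (pf⁻ * pf⁻))     ≡⟨ ℚ.*-identityˡ (pf⁺ * pf⁺ * (pf⁻ * pf⁻)) ⟩
          pf⁺ * pf⁺ * (pf⁻ * pf⁻)            ≡⟨ cong₂ (λ x y → x * x * (y * y)) pf⁺≡P pf⁻≡Q ⟩
          P * P * (Q * Q)                    ∎
          where
          open ≡-Reasoning
          D = wedges A one ⊤
          P = ∑ˡ (λ M → ρ M * matchingWeight M) (perfectMatchings G)
          Q = ∑ˡ (λ M → τ M * matchingWeight M) (perfectMatchings G)
          pf⁺ = pfaffian (uncurry A) (edges G)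
          pf⁻ = pfaffian (-_ ∘ uncurry A) (edges G)
          pf⁺≡P : pf⁺ ≡ P
          pf⁺≡P = signed-* (uncurry S) (uncurry A) (λ _ → refl)
          pf⁻≡Q : pf⁻ ≡ Q
          pf⁻≡Q = signed-* (-_ ∘ uncurry S) (-_ ∘ uncurry A) (λ (u , v) → ℚ.neg-distribˡ-* (S u v) (w u v))

        -- The entries of S square to one on edges and vanish elsewhere, so Hadamard's row norms are
        -- the weighted degrees.
        dot-A : ∀ k → dot (A k) (A k) ≡ ∑ˡ (λ u → w k u * w k u) (neighbours G k)
        dot-A k = trans (sym (∑ˡ-allFin (λ j → A k j * A k j))) (sym (∑ˡ-filter (k ~?_) on off (allFin n)))
          where
          on : ∀ u → k ~ u → w k u * w k u ≡ A k u * A k u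
          on u e = sym (trans (solve 2 (λ s x → s :* x :* (s :* x) := s :* s :* (x :* x)) refl (S k u) (w k u))
            (trans (cong (_* (w k u * w k u)) (sign² (S-sign e))) (ℚ.*-identityˡ _)))
          off : ∀ u → ¬ (k ~ u) → A k u * A k u ≡ 0ℚ
          off u ¬e = trans (cong (λ s → s * w k u * (s * w k u)) (S-nonedge k u ¬e))
            (solve 1 (λ x → con 0ℚ :* x :* (con 0ℚ :* x) := con 0ℚ) refl (w k u))

      module _ (pf : IsPfaffian G o) where

        private
          L = perfectMatchings G
          N = ∑ˡ (λ _ → 1ℚ) L

        -- The case w = 1, where A is S itself and the pfaffian property evaluates its determinant
        -- as N².
        signs-maximal : ∑ˡ ρ L * ∑ˡ ρ L * (∑ˡ τ L * ∑ˡ τ L) ≡ N * N * (N * N)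
        signs-maximal = begin
          ∑ˡ ρ L * ∑ˡ ρ L * (∑ˡ τ L * ∑ˡ τ L)        ≡⟨ cong₂ (λ x y → x * x * (y * y)) (unweighted ρ) (unweighted τ) ⟩
          _                                          ≡⟨ wedges-A² (λ _ _ → 1ℚ) (λ _ _ → refl) ⟨
          D * D                                      ≡⟨ cong (λ z → z * z) D≡N² ⟩
          N * N * (N * N)                            ∎
          where
          open ≡-Reasoning
          D = wedges (A (λ _ _ → 1ℚ) (λ _ _ → refl)) one ⊤
          unweighted : ∀ σ → ∑ˡ σ L ≡ ∑ˡ (λ M → σ M * ∏ˡ (λ _ → 1ℚ) M) L
          unweighted σ = ∑ˡ-cong (All.universal (λ M → sym (trans (cong (σ M *_) (∏ˡ-one M)) (ℚ.*-identityʳ (σ M)))) L)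
          D≡N² : D ≡ N * N
          D≡N² = begin
            D                                ≡⟨ wedges-cong (λ u v → ℚ.*-identityʳ (S u v)) one ⊤ ⟩
            wedges S one ⊤                   ≡⟨ det≡wedges skewAdjacency ⟨
            ι (det skewAdjacency)            ≡⟨ cong ι pf ⟩
            ι ((ℤ.+ perfmat G) ℤ.^ 2)        ≡⟨ cong (λ z → ι ((ℤ.+ perfmat G) ℤ.* z)) (ℤ.*-identityʳ (ℤ.+ perfmat G)) ⟩
            ι ((ℤ.+ perfmat G) ℤ.* (ℤ.+ perfmat G))  ≡⟨ ι-* (ℤ.+ perfmat G) (ℤ.+ perfmat G) ⟩
            ι (ℤ.+ perfmat G) * ι (ℤ.+ perfmat G)    ≡⟨ cong (λ z → z * z) (ι-length L) ⟩
            N * N                            ∎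

        perfmat⁴≤ : ∀ w → (∀ u v → w u v ≡ w v u) →
          let P = ∑ˡ (∏ˡ (uncurry w)) (perfectMatchings G) in
          (P * P) * (P * P) ≤ ∏ᶠ (λ v → ∑ˡ (λ u → w v u * w v u) (neighbours G v))
        perfmat⁴≤ w w-sym = begin
          -- Each signed sum is plus or minus P, and its square is P².
          P * P * (P * P)                ≡⟨ cong₂ _*_ (constant-∑ˡ ρ-constant W) (constant-∑ˡ τ-constant W) ⟨
          _                              ≡⟨ wedges-A² w w-sym ⟨
          wedges B one ⊤ * wedges B one ⊤  ≤⟨ hadamard B ⟩
          ∏ᶠ (λ v → dot (B v) (B v))     ≡⟨ cong (foldr _*_ 1ℚ) (List.tabulate-cong (dot-A w w-sym)) ⟩
          ∏ᶠ (λ v → ∑ˡ (λ u → w v u * w v u) (neighbours G v))  ∎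
          where
          open ℚ.≤-Reasoning
          B = A w w-sym
          W = ∏ˡ (uncurry w)
          P = ∑ˡ W L
          ρ-constant : Constant ρ L
          ρ-constant = ∑ˡ-signs-maximal⇒constant ρ-signs τ-signs signs-maximal
          τ-constant : Constant τ L
          τ-constant = ∑ˡ-signs-maximal⇒constant τ-signs ρ-signs
            (trans (ℚ.*-comm (∑ˡ τ L * ∑ˡ τ L) (∑ˡ ρ L * ∑ˡ ρ L)) signs-maximal)

  -- Real weights

  seq-∑ : ∀ {A : Set} (f : A → ℝ) xs k → seq (ℝ.∑ (map f xs)) k ≡ ∑ˡ (λ x → seq (f x) k) xs
  seq-∑ f []       k = refl
  seq-∑ f (x ∷ xs) k = cong (seq (f x) k +_) (seq-∑ f xs k)

  seq-∏ : ∀ {A : Set} (f : A → ℝ) xs k → seq (ℝ.∏ (map f xs)) k ≡ ∏ˡ (λ x → seq (f x) k) xs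
  seq-∏ f []       k = refl
  seq-∏ f (x ∷ xs) k = cong (seq (f x) k *_) (seq-∏ f xs k)

  seq-² : ∀ x k → seq (x ℝ.^ 2) k ≡ seq x k * seq x k
  seq-² x k = cong (seq x k *_) (ℚ.*-identityʳ (seq x k))

  ≈-refl : ∀ {x} → x ℝ.≈ x
  ≈-refl {x} ε 0<ε = 0 , λ n _ → subst (_< ε) (cong ∣_∣ (sym (ℚ.+-inverseʳ (seq x n)))) 0<ε

  ≈-trans : ∀ {x y z} → x ℝ.≈ y → y ℝ.≈ z → x ℝ.≈ z
  ≈-trans {x} {y} {z} x≈y y≈z ε 0<ε =
    let (M , h) = x≈y (ε * ½) (half-pos 0<ε)
        (N , k) = y≈z (ε * ½) (half-pos 0<ε)
    in M ℕ.⊔ N , λ n M⊔N≤n → subst (_< ε)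
         (cong ∣_∣ (solve 3 (λ x y z → (x :+ y) :- (y :+ z) := x :- z) refl (seq x n) (seq y n) (seq z n)))
         (+-close {seq x n} {seq y n} {seq y n} {seq z n}
           (h n (ℕ.m⊔n≤o⇒m≤o M N M⊔N≤n)) (k n (ℕ.m⊔n≤o⇒n≤o M N M⊔N≤n)))

  ∑-cong : ∀ {A : Set} {f g : A → ℝ} {xs} → All (λ x → f x ℝ.≈ g x) xs → ℝ.∑ (map f xs) ℝ.≈ ℝ.∑ (map g xs)
  ∑-cong                 []       = ≈-refl {0ℝ}
  ∑-cong {f = f} {g} {x ∷ xs} (e ∷ es) ε 0<ε =
    let (M , h) = e (ε * ½) (half-pos 0<ε)
        (N , k) = ∑-cong es (ε * ½) (half-pos 0<ε)
    in M ℕ.⊔ N , λ n M⊔N≤n → +-close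
         {seq (f x) n} {seq (ℝ.∑ (map f xs)) n} {seq (g x) n} {seq (ℝ.∑ (map g xs)) n}
         (h n (ℕ.m⊔n≤o⇒m≤o M N M⊔N≤n)) (k n (ℕ.m⊔n≤o⇒n≤o M N M⊔N≤n))

  ∏-cong : ∀ {A : Set} {f g : A → ℝ} xs → (∀ x → f x ℝ.≈ g x) → ℝ.∏ (map f xs) ℝ.≈ ℝ.∏ (map g xs)
  ∏-cong         []       e = ≈-refl {ℝ.1ℝ}
  ∏-cong {f = f} {g} (x ∷ xs) e =
    ℝ.*-cong {f x} {g x} {ℝ.∏ (map f xs)} {ℝ.∏ (map g xs)} (e x) (∏-cong xs e)

  ²-cong : ∀ {x y} → x ℝ.≈ y → x ℝ.^ 2 ℝ.≈ y ℝ.^ 2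
  ²-cong {x} {y} e =
    ℝ.*-cong {x} {y} {x ℝ.^ 1} {y ℝ.^ 1} e (ℝ.*-cong {x} {y} {ℝ.1ℝ} {ℝ.1ℝ} e (≈-refl {ℝ.1ℝ}))

  0≤seq⇒0≤ : ∀ {x} → (∀ k → 0ℚ ≤ seq x k) → 0ℝ ℝ.≤ x
  0≤seq⇒0≤ h ε 0<ε = 0 , λ k _ → nonNeg+nonNeg (h k) (ℚ.<⇒≤ 0<ε)

  ∑ˡ-nonNeg : ∀ {A : Set} {f : A → ℚ} xs → (∀ x → 0ℚ ≤ f x) → 0ℚ ≤ ∑ˡ f xs
  ∑ˡ-nonNeg []       h = ℚ.≤-refl
  ∑ˡ-nonNeg (x ∷ xs) h = nonNeg+nonNeg (h x) (∑ˡ-nonNeg xs h)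

  ∏ˡ-nonNeg : ∀ {A : Set} {f : A → ℚ} xs → (∀ x → 0ℚ ≤ f x) → 0ℚ ≤ ∏ˡ f xs
  ∏ˡ-nonNeg []       h = *≤* (ℤ.+≤+ ℕ.z≤n)
  ∏ˡ-nonNeg (x ∷ xs) h = nonNeg*nonNeg (h x) (∏ˡ-nonNeg xs h)

  ∏ˡ-⁴ : ∀ {A : Set} (f : A → ℚ) xs → ∏ˡ (λ x → f x ⁴) xs ≡ ∏ˡ f xs ⁴
  ∏ˡ-⁴ f xs = trans (∏ˡ-* (λ x → f x * f x) (λ x → f x * f x) xs) (cong (λ z → z * z) (∏ˡ-* f f xs))

  -- Superadditivity, q⁴ + ε⁴ ≤ (q + ε)⁴, takes the place of uniform continuity of the fourth root,
  -- also near zero.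
  ⁴-cancel-≤ : ∀ {p q ε} → 0ℚ ≤ q → 0ℚ < ε → p ⁴ < q ⁴ + ε ⁴ → p ≤ q + ε
  ⁴-cancel-≤ 0≤q 0<ε h = ℚ.≮⇒≥ λ q+ε<p → ℚ.<-irrefl refl (ℚ.<-≤-trans h (ℚ.≤-trans
    (⁴-superadd 0≤q (ℚ.<⇒≤ 0<ε)) (⁴-mono (nonNeg+nonNeg 0≤q (ℚ.<⇒≤ 0<ε)) (ℚ.<⇒≤ q+ε<p))))

  -- Roots are taken of `d`, whereas the termwise hypothesis speaks of `d′`, an equal real given by
  -- a possibly different sequence. The fourth power of the product of roots converges to the
  -- product of the `d′`.
  ≤∏⁴√ : ∀ {n} {x} {d d′ : Fin n → ℝ} → (∀ v → 0ℝ ℝ.≤ d v) → (∀ v → d v ℝ.≈ d′ v) →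
         (∀ k → seq x k ⁴ ≤ ∏ᶠ (λ v → seq (d′ v) k)) → x ℝ.≤ ∏ᵛ (λ v → ⁴√ (d v))
  ≤∏⁴√ {n} {x} {d} {d′} 0≤d d≈d′ h ε 0<ε =
    -- The tolerance is ε⁴ because an error of that size in the fourth powers becomes an error ε
    -- after `⁴-cancel-≤`.
    let (N , close) = ∏-cong (allFin n)
          (λ v → ≈-trans {(⁴√ d v) ℝ.^ 4} {d v} {d′ v} (⁴√-correct (d v) (0≤d v)) (d≈d′ v)) (ε ⁴) (⁴-pos 0<ε)
    in N , λ k N≤k → ⁴-cancel-≤ (subst (0ℚ ≤_) (sym (seq-∏ r (allFin n) k)) (∏ˡ-nonNeg (allFin n) (r-nonNeg k))) 0<ε
      (begin-strict
        seq x k ⁴                                      ≤⟨ h k ⟩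
        ∏ᶠ (λ v → seq (d′ v) k)                        ≡⟨ cong (foldr _*_ 1ℚ) (List.map-tabulate id (λ v → seq (d′ v) k)) ⟨
        ∏ˡ (λ v → seq (d′ v) k) (allFin n)             ≡⟨ seq-∏ d′ (allFin n) k ⟨
        seq (∏ᵛ d′) k                                  <⟨ abs<⇒<+ (subst (_< ε ⁴) (∣p-q∣≡∣q-p∣ (seq (∏ᵛ (λ v → r v ℝ.^ 4)) k) _) (close k N≤k)) ⟩
        seq (∏ᵛ (λ v → r v ℝ.^ 4)) k + ε ⁴             ≡⟨ cong (_+ ε ⁴) (fourth-powers k) ⟩
        seq (∏ᵛ r) k ⁴ + ε ⁴                           ∎)
    where
    open ℚ.≤-Reasoning
    r : Fin n → ℝ
    r v = ⁴√ (d v)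
    r-nonNeg : ∀ k v → 0ℚ ≤ seq (r v) k
    r-nonNeg k v = ApproxRoot.nonNeg (approxRoot-correct k (seq (d v) k))
    fourth-powers : ∀ k → seq (∏ᵛ (λ v → r v ℝ.^ 4)) k ≡ seq (∏ᵛ r) k ⁴
    fourth-powers k = trans (seq-∏ (λ v → r v ℝ.^ 4) (allFin n) k)
      (trans (∏ˡ-cong (All.universal (λ v → expand-⁴ (seq (r v) k)) (allFin n)))
      (trans (∏ˡ-⁴ (λ v → seq (r v) k) (allFin n)) (cong _⁴ (sym (seq-∏ r (allFin n) k)))))

  -- The weighted and the unweighted bound.

  module _ {n : ℕ} (G : Graph n) (o : Orientation G) (pf : IsPfaffian G o) where
    open Graph G

    -- weight u v and weight v u agree only in the limit, so the rational bound is applied termwise to the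
    -- weights read off from the pairs u < v.
    module _ (w : WeightFunction G) where
      open WeightFunction w

      symmetrised : Fin n → Fin n → ℝ
      symmetrised u v with u Fin.<? v
      ... | yes _ = weight u v
      ... | no  _ = weight v u

      symmetrised-sym : ∀ u v → symmetrised u v ≡ symmetrised v u
      symmetrised-sym u v with u Fin.<? v | v Fin.<? u
      ... | yes u<v | yes v<u = contradiction v<u (Fin.<-asym u<v)
      ... | yes _   | no  _   = refl
      ... | no  _   | yes _   = refl
      ... | no  u≮v | no  v≮u with refl ← Fin.≤-antisym (ℕ.≮⇒≥ v≮u) (ℕ.≮⇒≥ u≮v) = refl

      symmetrised-< : ∀ {u v} → u Fin.< v → symmetrised u v ≡ weight u v
      symmetrised-< {u} {v} u<v with u Fin.<? v
      ... | yes _   = refl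
      ... | no  u≮v = contradiction u<v u≮v

      weight≈symmetrised : ∀ {u v} → u ~ v → weight u v ℝ.≈ symmetrised u v
      weight≈symmetrised {u} {v} e with u Fin.<? v
      ... | yes _ = ≈-refl {weight u v}
      ... | no  _ = symm e

      degree₂′ : Fin n → ℝ
      degree₂′ v = ℝ.∑ (map (λ u → symmetrised u v ℝ.^ 2) (neighbours G v))

      degree₂≈degree₂′ : ∀ v → degree₂ G w v ℝ.≈ degree₂′ v
      degree₂≈degree₂′ v = ∑-cong (All.map
        (λ {u} v~u → ²-cong {weight u v} {symmetrised u v} (weight≈symmetrised (~-sym v~u)))
        (All.all-filter (v ~?_) (allFin n)))

      degree₂-nonNeg : ∀ v → 0ℝ ℝ.≤ degree₂ G w v
      degree₂-nonNeg v = 0≤seq⇒0≤ {degree₂ G w v} λ k →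
        subst (0ℚ ≤_) (sym (seq-∑ (λ u → weight u v ℝ.^ 2) (neighbours G v) k))
          (∑ˡ-nonNeg (neighbours G v) λ u → subst (0ℚ ≤_) (sym (seq-² (weight u v) k)) (p*p≥0 (seq (weight u v) k)))

      perfmatʷ≤ : perfmatʷ G w ℝ.≤ ∏ᵛ (λ v → ⁴√ (degree₂ G w v))
      perfmatʷ≤ = ≤∏⁴√ {x = perfmatʷ G w} {degree₂ G w} {degree₂′} degree₂-nonNeg degree₂≈degree₂′ λ k →
        let w′ = λ u v → seq (symmetrised u v) k in begin
        seq (perfmatʷ G w) k ⁴  ≡⟨ cong _⁴ (matchings k) ⟩
        ∑ˡ (∏ˡ (uncurry w′)) (perfectMatchings G) ⁴
          ≤⟨ perfmat⁴≤ G o pf w′ (λ u v → cong (λ x → seq x k) (symmetrised-sym u v)) ⟩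
        ∏ᶠ (λ v → ∑ˡ (λ u → w′ v u * w′ v u) (neighbours G v))
          ≡⟨ cong (foldr _*_ 1ℚ) (List.tabulate-cong (degrees k)) ⟩
        ∏ᶠ (λ v → seq (degree₂′ v) k)  ∎
        where
        open ℚ.≤-Reasoning
        matchings : ∀ k → seq (perfmatʷ G w) k ≡ ∑ˡ (∏ˡ (uncurry (λ u v → seq (symmetrised u v) k))) (perfectMatchings G)
        matchings k = trans (seq-∑ (λ M → ℝ.∏ (map (uncurry weight) M)) (perfectMatchings G) k)
          (∑ˡ-cong (All.map (λ {M} (_ , M-edges) → trans (seq-∏ (uncurry weight) M k)
            (∏ˡ-cong (All.map (λ (u<v , _) → cong (λ x → seq x k) (sym (symmetrised-< u<v))) M-edges)))
            (perfectMatchings-All G)))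
        degrees : ∀ k v → ∑ˡ (λ u → seq (symmetrised v u) k * seq (symmetrised v u) k) (neighbours G v) ≡ seq (degree₂′ v) k
        degrees k v = trans (∑ˡ-cong (All.universal
          (λ u → trans (cong (λ x → seq x k * seq x k) (symmetrised-sym v u)) (sym (seq-² (symmetrised u v) k))) (neighbours G v)))
          (sym (seq-∑ (λ u → symmetrised u v ℝ.^ 2) (neighbours G v) k))

    -- All reals here are constant sequences, so the rational inequality with weight 1 applies at
    -- every index directly.
    perfmat≤ : fromℕ (perfmat G) ℝ.≤ ∏ᵛ (λ v → ⁴√ (fromℕ (degree G v)))
    perfmat≤ = ≤∏⁴√ {x = fromℕ (perfmat G)} {λ v → fromℕ (degree G v)} {λ v → fromℕ (degree G v)}
      (λ v → 0≤seq⇒0≤ {fromℕ (degree G v)} λ _ → subst (0ℚ ≤_) (sym (ι-length (neighbours G v)))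
        (∑ˡ-nonNeg (neighbours G v) λ _ → p*p≥0 1ℚ))
      (λ v → ≈-refl {fromℕ (degree G v)}) λ _ → begin
      ι (ℤ.+ perfmat G) ⁴  ≡⟨ cong _⁴ (ι-length (perfectMatchings G)) ⟩
      ∑ˡ (λ _ → 1ℚ) (perfectMatchings G) ⁴
        ≡⟨ cong _⁴ (∑ˡ-cong (All.universal (sym ∘ ∏ˡ-one) (perfectMatchings G))) ⟩
      ∑ˡ (∏ˡ (λ _ → 1ℚ)) (perfectMatchings G) ⁴
        ≤⟨ perfmat⁴≤ G o pf (λ _ _ → 1ℚ) (λ _ _ → refl) ⟩
      ∏ᶠ (λ v → ∑ˡ (λ _ → 1ℚ) (neighbours G v))
        ≡⟨ cong (foldr _*_ 1ℚ) (List.tabulate-cong (λ v → ι-length (neighbours G v))) ⟨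
      ∏ᶠ (λ v → ι (ℤ.+ degree G v))  ∎
      where open ℚ.≤-Reasoning

open import Defs

theorem3p1 : (n : ℕ) → 2 ∣ n → (G : Graph n) → HasPfaffianOrientation G →
    ((w : WeightFunction G) → perfmatʷ G w ≤ ∏ᵛ (λ v → ⁴√ (degree₂ G w v)))
    × (fromℕ (perfmat G) ≤ ∏ᵛ (λ v → ⁴√ (fromℕ (degree G v))))
theorem3p1 n _ G (o , pf) = perfmatʷ≤ G o pf , perfmat≤ G o pf
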